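{- Let $k \ge 4$ and let $\tau_k = k\,(k-1)\ldots 4\,2\,1\,3 \in S_k$. Then there exist constants $a, b$, integers $r, s$, and a polynomial $p$ of degree $k-2$ such that for all $n \ge k$, $$|S_n(132, \tau_k, 2341)| = a F_{n+r} + b F_{n+s} + p(n).$$
   Context: Permutations of $[n]$ are written in one-line notation, and $S_n$ denotes the set of them. A permutation $\pi\in S_n$ contains $\sigma\in S_m$ if there are indices $i_1<\dots<i_m$ such that for all $a,b$, $\pi(i_a)<\pi(i_b)$ iff $\sigma(a)<\sigma(b)$; otherwise $\pi$ avoids $\sigma$. For a set $R$ of permutations, $S_n(R)$ is the set of $\pi\in S_n$ avoiding every element of $R$. The permutation $k\,(k-1)\ldots 4\,2\,1\,3$ lists $k,k-1,\dots,4$ in decreasing order followed by $2,1,3$ (e.g. $4213$ for $k=4$, $54213$ for $k=5$). $F_n$ denotes the Fibonacci numbers with $F_0=0$, $F_1=F_2=1$, $F_n=F_{n-1}+F_{n-2}$ (extended to negative indices by the same recurrence if needed). -}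

module Defs where

open import Data.Nat using (ℕ; zero; suc; _<ᵇ_; _≡ᵇ_)
import Data.Nat
open import Data.Bool using (Bool; true; false; _∧_; _∨_; not; if_then_else_)
open import Data.List using (List; []; _∷_; _++_; map; concatMap; length; filter; reverse)
open import Data.Bool.ListAction using (any; all)
open import Data.Integer as ℤ using (ℤ; +_; -[1+_])
open import Data.Rational as ℚ using (ℚ; _/_; 0ℚ)
open import Relation.Nullary.Decidable using (does)
open import Data.Bool.Properties using (T?)
open import Data.Bool using (T)

-- Permutations of [n] in one-line notation, as lists over {1,…,n}.

insertions : ℕ → List ℕ → List (List ℕ)
insertions x [] = (x ∷ []) ∷ []
insertions x (y ∷ ys) = (x ∷ y ∷ ys) ∷ map (y ∷_) (insertions x ys)

-- S n : the list of all permutations of [n] (each exactly once),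
-- built by inserting n into every position of each permutation of [n-1].
S : ℕ → List (List ℕ)
S zero = [] ∷ []
S (suc n) = concatMap (insertions (suc n)) (S n)

subseqs : List ℕ → List (List ℕ)
subseqs [] = [] ∷ []
subseqs (x ∷ xs) = map (x ∷_) (subseqs xs) ++ subseqs xs

sameCmp : ℕ → ℕ → ℕ → ℕ → Bool
sameCmp x₁ x₂ y₁ y₂ = not ((x₁ <ᵇ x₂) ∧ not (y₁ <ᵇ y₂)) ∧ not ((y₁ <ᵇ y₂) ∧ not (x₁ <ᵇ x₂))

headAgrees : ℕ → ℕ → List ℕ → List ℕ → Bool
headAgrees x y [] [] = true
headAgrees x y (x′ ∷ xs) (y′ ∷ ys) =
  sameCmp x x′ y y′ ∧ sameCmp x′ x y′ y ∧ headAgrees x y xs ys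
headAgrees x y _ _ = false

orderIso : List ℕ → List ℕ → Bool
orderIso [] [] = true
orderIso (x ∷ xs) (y ∷ ys) = headAgrees x y xs ys ∧ orderIso xs ys
orderIso _ _ = false

contains : List ℕ → List ℕ → Bool
contains π σ = any (λ t → orderIso t σ) (subseqs π)

avoidsAll : List (List ℕ) → List ℕ → Bool
avoidsAll R π = all (λ σ → not (contains π σ)) R

countAvoid : List (List ℕ) → ℕ → ℕ
countAvoid R n = length (filter (λ π → T? (avoidsAll R π)) (S n))

downTo4 : ℕ → List ℕ
downTo4 zero = []
downTo4 (suc m) = if (suc m) <ᵇ 4 then [] else (suc m ∷ downTo4 m)

tau : ℕ → List ℕ
tau k = downTo4 k ++ (2 ∷ 1 ∷ 3 ∷ [])

p132 p2341 : List ℕ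
p132 = 1 ∷ 3 ∷ 2 ∷ []
p2341 = 2 ∷ 3 ∷ 4 ∷ 1 ∷ []

-- Fibonacci numbers, F₀ = 0, F₁ = 1, extended to ℤ by the same recurrence
-- (F₋ₘ = (-1)^{m+1} Fₘ).

fib : ℕ → ℕ
fib zero = 0
fib (suc zero) = 1
fib (suc (suc n)) = fib (suc n) Data.Nat.+ fib n

fibℤ : ℤ → ℤ
fibℤ (+ n) = + fib n
fibℤ -[1+ m ] = if (m Data.Nat.% 2) ≡ᵇ 0 then + fib (suc m) else ℤ.- (+ fib (suc m))

ℤtoℚ : ℤ → ℚ
ℤtoℚ z = z / 1

evalPoly : List ℚ → ℚ → ℚ
evalPoly [] x = 0ℚ
evalPoly (c ∷ cs) x = c ℚ.+ x ℚ.* evalPoly cs x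

{-# OPTIONS --safe #-}
-- For k ≥ 4, insert a new maximum M into a nonempty ρ = L R avoiding 132, τ_k, 2341. M may go last; M may go first
-- iff ρ avoids τ_(k−1); M may go strictly between L and R iff every letter of L exceeds all letters to its
-- right (132 forces L > R, then 2341 forces L to decrease). Let φ count the avoiders of size n and ψ the pairs of an
-- avoider and such an inner position. With i = k − 3,
--     φ (i+1) (n+1) = φ i n + φ (i+1) n + ψ (i+1) n    and    ψ (i+1) (n+1) = φ i n + ψ i n,
-- while φ 0 n + 1 satisfies the Fibonacci recurrence. Sequences "Fibonacci-type plus polynomial" are closed under
-- addition, shift and summation; each step in i raises the degree by one and doubles the iterated difference that
-- controls the leading coefficient, which starts at −1 and so never vanishes.
module Submission where

open import Defs

module Counting where

  open import Data.Bool using (true; false; T; _∧_; not; if_then_else_)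
  open import Data.Bool.Properties using (T?; T-∧)
  open import Data.Empty using (⊥-elim)
  open import Data.List using (List; []; _∷_; _++_; map; concatMap; length; filter)
  open import Data.List.Membership.Propositional using (_∈_; find; lose)
  open import Data.List.Membership.Propositional.Properties using (∈-++⁺ˡ; ∈-++⁺ʳ; ∈-++⁻; ∈-map⁺; ∈-map⁻)
  open import Data.List.Properties using (++-identityʳ; ++-assoc)
  open import Data.List.Relation.Binary.Permutation.Propositional
    using (_↭_; ↭-refl; ↭⇒↭ₛ; ↭-sym; ↭-trans; prep; swap)
  open import Data.List.Relation.Binary.Permutation.Propositional.Properties using (All-resp-↭; ∈-resp-↭; ↭-length)
  import Data.List.Relation.Binary.Permutation.Setoid.Properties as Perm
  open import Data.List.Relation.Binary.Pointwise using (Pointwise; []; _∷_)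
  open import Data.List.Relation.Binary.Sublist.Propositional
    using (_⊆_; []; _∷_; _∷ʳ_; ⊆-refl; ⊆-trans; minimum; to∈; from∈)
  open import Data.List.Relation.Binary.Sublist.Propositional.Properties using (All-resp-⊆; ++⁺; ++⁺ˡ; ++⁺ʳ)
  open import Data.List.Relation.Unary.All as All using (All; []; _∷_)
  import Data.List.Relation.Unary.All.Properties as All
  open import Data.List.Relation.Unary.AllPairs as AllPairs using (AllPairs; []; _∷_)
  import Data.List.Relation.Unary.AllPairs.Properties as AllPairs
  open import Data.List.Relation.Unary.Any using (here; there)
  open import Data.List.Relation.Unary.Any.Properties using (any⁺; any⁻)
  open import Data.List.Relation.Unary.Unique.Propositional using (Unique)
  open import Data.Nat using (ℕ; zero; suc; _+_; _*_; _<_; _<ᵇ_; _<?_)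
  open import Data.Nat.ListAction using (sum)
  open import Data.Nat.Properties
  open import Data.Nat.Solver using (module +-*-Solver)
  open import Data.Product using (∃; ∃₂; _×_; _,_; proj₁; proj₂)
  open import Data.Sum using (_⊎_; inj₁; inj₂)
  open import Data.Unit using (⊤; tt)
  open import Function using (_∘_; case_of_; _⇔_; mk⇔; Equivalence)
  open import Relation.Binary.Definitions using (tri<; tri≈; tri>)
  open import Relation.Binary.PropositionalEquality
  open import Relation.Nullary using (¬_; Dec; yes; no; contradiction)
  open import Relation.Nullary.Decidable using (does; map′; _×-dec_; dec-true; dec-false)

  open Equivalence using (to; from)

  -- Boolean pattern containment as a relation on subsequences.

  SameOrder : ℕ → ℕ → ℕ → ℕ → Set
  SameOrder x y x′ y′ = (x < x′ ⇔ y < y′) × (x′ < x ⇔ y′ < y)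

  data Iso : List ℕ → List ℕ → Set where
    []  : Iso [] []
    _∷_ : ∀ {x y xs ys} → Pointwise (SameOrder x y) xs ys → Iso xs ys → Iso (x ∷ xs) (y ∷ ys)

  T-xnor⁻ : ∀ a b → T (not (a ∧ not b) ∧ not (b ∧ not a)) → T a ⇔ T b
  T-xnor⁻ true  true  _ = mk⇔ (λ z → z) (λ z → z)
  T-xnor⁻ false false _ = mk⇔ (λ z → z) (λ z → z)

  T-xnor⁺ : ∀ a b → T a ⇔ T b → T (not (a ∧ not b) ∧ not (b ∧ not a))
  T-xnor⁺ true  true  _ = tt
  T-xnor⁺ false false _ = tt
  T-xnor⁺ true  false e = to e tt
  T-xnor⁺ false true  e = from e tt

  sameCmp⁻ : ∀ x x′ y y′ → T (sameCmp x x′ y y′) → x < x′ ⇔ y < y′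
  sameCmp⁻ x x′ y y′ h = mk⇔ (<ᵇ⇒< y y′ ∘ to e ∘ <⇒<ᵇ) (<ᵇ⇒< x x′ ∘ from e ∘ <⇒<ᵇ)
    where e = T-xnor⁻ (x <ᵇ x′) (y <ᵇ y′) h

  sameCmp⁺ : ∀ x x′ y y′ → x < x′ ⇔ y < y′ → T (sameCmp x x′ y y′)
  sameCmp⁺ x x′ y y′ e = T-xnor⁺ (x <ᵇ x′) (y <ᵇ y′)
    (mk⇔ (<⇒<ᵇ ∘ to e ∘ <ᵇ⇒< x x′) (<⇒<ᵇ ∘ from e ∘ <ᵇ⇒< y y′))

  headAgrees⁻ : ∀ x y xs ys → T (headAgrees x y xs ys) → Pointwise (SameOrder x y) xs ys
  headAgrees⁻ x y [] [] _ = []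
  headAgrees⁻ x y (x′ ∷ xs) (y′ ∷ ys) h =
    let h₁ , h₂₃ = to T-∧ h; h₂ , h₃ = to T-∧ h₂₃
    in (sameCmp⁻ x x′ y y′ h₁ , sameCmp⁻ x′ x y′ y h₂) ∷ headAgrees⁻ x y xs ys h₃

  headAgrees⁺ : ∀ {x y xs ys} → Pointwise (SameOrder x y) xs ys → T (headAgrees x y xs ys)
  headAgrees⁺ [] = tt
  headAgrees⁺ ((p , q) ∷ ps) =
    from T-∧ (sameCmp⁺ _ _ _ _ p , from T-∧ (sameCmp⁺ _ _ _ _ q , headAgrees⁺ ps))

  orderIso⁻ : ∀ xs ys → T (orderIso xs ys) → Iso xs ys
  orderIso⁻ [] [] _ = []
  orderIso⁻ (x ∷ xs) (y ∷ ys) h =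
    let h₁ , h₂ = to T-∧ h in headAgrees⁻ x y xs ys h₁ ∷ orderIso⁻ xs ys h₂

  orderIso⁺ : ∀ {xs ys} → Iso xs ys → T (orderIso xs ys)
  orderIso⁺ [] = tt
  orderIso⁺ (p ∷ ps) = from T-∧ (headAgrees⁺ p , orderIso⁺ ps)

  Occurs : (List ℕ → Set) → List ℕ → Set
  Occurs P π = ∃ λ t → t ⊆ π × P t

  subseqs⁻ : ∀ π {t} → t ∈ subseqs π → t ⊆ π
  subseqs⁻ [] (here refl) = []
  subseqs⁻ (x ∷ π) t∈ with ∈-++⁻ (map (x ∷_) (subseqs π)) t∈
  ... | inj₂ t∈′ = x ∷ʳ subseqs⁻ π t∈′
  ... | inj₁ t∈′ with ∈-map⁻ (x ∷_) t∈′
  ...   | _ , t′∈ , refl = refl ∷ subseqs⁻ π t′∈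

  subseqs⁺ : ∀ {π t} → t ⊆ π → t ∈ subseqs π
  subseqs⁺ [] = here refl
  subseqs⁺ (_∷ʳ_ {xs = t} {ys = π} x s) = ∈-++⁺ʳ (map (x ∷_) (subseqs π)) (subseqs⁺ s)
  subseqs⁺ (refl ∷ s) = ∈-++⁺ˡ (∈-map⁺ _ (subseqs⁺ s))

  contains⁻ : ∀ π σ → T (contains π σ) → Occurs (λ t → Iso t σ) π
  contains⁻ π σ h with find (any⁻ (λ t → orderIso t σ) (subseqs π) h)
  ... | t , t∈ , iso = t , subseqs⁻ π t∈ , orderIso⁻ t σ iso

  contains⁺ : ∀ π σ → Occurs (λ t → Iso t σ) π → T (contains π σ)
  contains⁺ π σ (t , s , iso) = any⁺ (λ t → orderIso t σ) (lose (subseqs⁺ s) (orderIso⁺ iso))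

  -- The three patterns as chains of inequalities.

  data Is132 : List ℕ → Set where
    is132 : ∀ {a b c} → a < b → b < c → Is132 (a ∷ c ∷ b ∷ [])

  data Is2341 : List ℕ → Set where
    is2341 : ∀ {a b c d} → a < b → b < c → c < d → Is2341 (b ∷ c ∷ d ∷ a ∷ [])

  -- Order isomorphism to τ with i letters before its final 213, that is, to tau (3 + i).
  data IsTau : ℕ → List ℕ → Set where
    is213 : ∀ {a b c} → a < b → b < c → IsTau 0 (b ∷ a ∷ c ∷ [])
    _∷_   : ∀ {i x t} → All (_< x) t → IsTau i t → IsTau (suc i) (x ∷ t)

  both< : ∀ {x y x′ y′} → x < x′ → y < y′ → SameOrder x y x′ y′
  both< p q = mk⇔ (λ _ → q) (λ _ → p) , mk⇔ (⊥-elim ∘ <-asym p) (⊥-elim ∘ <-asym q)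

  both> : ∀ {x y x′ y′} → x′ < x → y′ < y → SameOrder x y x′ y′
  both> p q = mk⇔ (⊥-elim ∘ <-asym p) (⊥-elim ∘ <-asym q) , mk⇔ (λ _ → q) (λ _ → p)

  lt : ∀ m {n} → T (m <ᵇ n) → m < n
  lt m {n} = <ᵇ⇒< m n

  iso132⁻ : ∀ {t} → Iso t p132 → Is132 t
  iso132⁻ ((_ ∷ ab ∷ []) ∷ (bc ∷ []) ∷ [] ∷ []) = is132 (from (proj₁ ab) (lt 1 tt)) (from (proj₂ bc) (lt 2 tt))

  iso132⁺ : ∀ {t} → Is132 t → Iso t p132
  iso132⁺ (is132 p q) =
    (both< (<-trans p q) (lt 1 tt) ∷ both< p (lt 1 tt) ∷ []) ∷ (both> q (lt 2 tt) ∷ []) ∷ [] ∷ []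

  iso2341⁻ : ∀ {t} → Iso t p2341 → Is2341 t
  iso2341⁻ ((bc ∷ _ ∷ ba ∷ []) ∷ (cd ∷ _ ∷ []) ∷ (_ ∷ []) ∷ [] ∷ []) =
    is2341 (from (proj₂ ba) (lt 1 tt)) (from (proj₁ bc) (lt 2 tt)) (from (proj₁ cd) (lt 3 tt))

  iso2341⁺ : ∀ {t} → Is2341 t → Iso t p2341
  iso2341⁺ (is2341 p q r) =
    (both< q (lt 2 tt) ∷ both< (<-trans q r) (lt 2 tt) ∷ both> p (lt 1 tt) ∷ [])
    ∷ (both< r (lt 3 tt) ∷ both> (<-trans p q) (lt 1 tt) ∷ [])
    ∷ (both> (<-trans (<-trans p q) r) (lt 1 tt) ∷ [])
    ∷ [] ∷ []

  -- `tau (4 + i)` computes to `4 + i` followed by `tau (3 + i)`. The bound therefore makes each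
  -- prepended letter the largest so far, which is what matches order isomorphism with the recursive
  -- `IsTau`.
  tau-bound : ∀ i → All (_< 4 + i) (tau (3 + i))
  tau-bound zero    = lt 2 tt ∷ lt 1 tt ∷ lt 3 tt ∷ []
  tau-bound (suc i) = ≤-refl ∷ All.map m<n⇒m<1+n (tau-bound i)

  below⁻ : ∀ {x y t ys} → All (_< y) ys → Pointwise (SameOrder x y) t ys → All (_< x) t
  below⁻ [] [] = []
  below⁻ (y< ∷ ys<) (e ∷ es) = from (proj₂ e) y< ∷ below⁻ ys< es

  below⁺ : ∀ {x y t ys} → All (_< x) t → All (_< y) ys → Iso t ys → Pointwise (SameOrder x y) t ys
  below⁺ [] [] [] = []
  below⁺ (p ∷ ps) (q ∷ qs) (_ ∷ iso) = both> p q ∷ below⁺ ps qs iso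

  isoTau⁻ : ∀ i {t} → Iso t (tau (3 + i)) → IsTau i t
  isoTau⁻ zero ((ba ∷ bc ∷ []) ∷ (_ ∷ []) ∷ [] ∷ []) =
    is213 (from (proj₂ ba) (lt 1 tt)) (from (proj₁ bc) (lt 2 tt))
  isoTau⁻ (suc i) (p ∷ iso) = below⁻ (tau-bound i) p ∷ isoTau⁻ i iso

  isoTau⁺ : ∀ {i t} → IsTau i t → Iso t (tau (3 + i))
  isoTau⁺ (is213 p q) =
    (both> p (lt 1 tt) ∷ both< q (lt 2 tt) ∷ []) ∷ (both< (<-trans p q) (lt 1 tt) ∷ []) ∷ [] ∷ []
  isoTau⁺ (_∷_ {i} ps τ) = below⁺ ps (tau-bound i) (isoTau⁺ τ) ∷ isoTau⁺ τ

  -- Simultaneous avoidance of the three patterns.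

  record Avoids (i : ℕ) (π : List ℕ) : Set where
    constructor avoids
    field
      no132  : ¬ Occurs Is132 π
      noTau  : ¬ Occurs (IsTau i) π
      no2341 : ¬ Occurs Is2341 π
  open Avoids

  -- The theorem concerns `patterns (suc i)` with k = 4 + i. At index 0 the middle pattern is 213,
  -- the starting point of the recurrence in i.
  patterns : ℕ → List (List ℕ)
  patterns i = p132 ∷ tau (3 + i) ∷ p2341 ∷ []

  T-not⁻ : ∀ b → T (not b) → ¬ T b
  T-not⁻ false _ ()

  T-not⁺ : ∀ b → ¬ T b → T (not b)
  T-not⁺ true  h = h tt
  T-not⁺ false _ = tt

  avoidsAll⁻ : ∀ i π → T (avoidsAll (patterns i) π) → Avoids i π
  avoidsAll⁻ i π h =
    let h₁ , h₂₃ = to T-∧ h; h₂ , h₃₄ = to T-∧ h₂₃; h₃ , _ = to T-∧ h₃₄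
    in avoids (λ (t , s , p) → T-not⁻ _ h₁ (contains⁺ π p132 (t , s , iso132⁺ p)))
              (λ (t , s , p) → T-not⁻ _ h₂ (contains⁺ π (tau (3 + i)) (t , s , isoTau⁺ p)))
              (λ (t , s , p) → T-not⁻ _ h₃ (contains⁺ π p2341 (t , s , iso2341⁺ p)))

  avoidsAll⁺ : ∀ i π → Avoids i π → T (avoidsAll (patterns i) π)
  avoidsAll⁺ i π (avoids n₁ n₂ n₃) =
    from T-∧ (T-not⁺ _ (λ h → let t , s , p = contains⁻ π p132 h in n₁ (t , s , iso132⁻ p)) ,
    from T-∧ (T-not⁺ _ (λ h → let t , s , p = contains⁻ π (tau (3 + i)) h in n₂ (t , s , isoTau⁻ i p)) ,
    from T-∧ (T-not⁺ _ (λ h → let t , s , p = contains⁻ π p2341 h in n₃ (t , s , iso2341⁻ p)) , tt)))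

  Occurs-mono : ∀ {P π ρ} → π ⊆ ρ → Occurs P π → Occurs P ρ
  Occurs-mono s (t , s′ , p) = t , ⊆-trans s′ s , p

  Avoids-anti : ∀ {i π ρ} → π ⊆ ρ → Avoids i ρ → Avoids i π
  Avoids-anti s (avoids n₁ n₂ n₃) = avoids (n₁ ∘ Occurs-mono s) (n₂ ∘ Occurs-mono s) (n₃ ∘ Occurs-mono s)

  -- Pattern occurrences created by a new maximum.

  delete-⊆ : ∀ (L : List ℕ) {M R} → L ++ R ⊆ L ++ M ∷ R
  delete-⊆ L = ++⁺ (⊆-refl {x = L}) (_ ∷ʳ ⊆-refl)

  data Split (L : List ℕ) (M : ℕ) (R : List ℕ) : List ℕ → Set where
    without : ∀ {t} → t ⊆ L ++ R → Split L M R t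
    through : ∀ t₁ t₂ → t₁ ⊆ L → t₂ ⊆ R → Split L M R (t₁ ++ M ∷ t₂)

  split : ∀ L {M R t} → t ⊆ L ++ M ∷ R → Split L M R t
  split [] (_ ∷ʳ s)   = without s
  split [] (refl ∷ s) = through [] _ [] s
  split (x ∷ L) (_ ∷ʳ s) with split L s
  ... | without s′ = without (x ∷ʳ s′)
  ... | through t₁ t₂ s₁ s₂ = through t₁ t₂ (x ∷ʳ s₁) s₂
  split (x ∷ L) (refl ∷ s) with split L s
  ... | without s′ = without (refl ∷ s′)
  ... | through t₁ t₂ s₁ s₂ = through (x ∷ t₁) t₂ (refl ∷ s₁) s₂

  module _ {L : List ℕ} {M : ℕ} {R : List ℕ} (L< : All (_< M) L) (R< : All (_< M) R) where

    -- An occurrence through M must use it as the largest letter of the pattern; any other role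
    -- contradicts an inequality of the pattern. Here M is the 3, so the 1 lies in L and the 2 in R.
    -- The next three lemmas argue in the same way.
    insert-132 : Occurs Is132 (L ++ M ∷ R) →
      Occurs Is132 (L ++ R) ⊎ ∃₂ λ a b → a ∈ L × b ∈ R × a < b
    insert-132 (t , s , p) with split L s
    insert-132 (t , s , p) | without s′ = inj₁ (t , s′ , p)
    insert-132 (t , s , is132 p q) | through [] _ s₁ s₂ with All-resp-⊆ s₂ R<
    ... | _ ∷ b<M ∷ [] = contradiction p (<-asym b<M)
    insert-132 (t , s , is132 p q) | through (a ∷ []) (b ∷ []) s₁ s₂ = inj₂ (a , b , to∈ s₁ , to∈ s₂ , p)
    insert-132 (t , s , is132 p q) | through (a ∷ c ∷ []) _ s₁ s₂ with All-resp-⊆ s₁ L<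
    ... | _ ∷ c<M ∷ [] = contradiction q (<-asym c<M)
    insert-132 (t , s , ()) | through (a ∷ c ∷ b ∷ []) _ s₁ s₂
    insert-132 (t , s , ()) | through (a ∷ c ∷ b ∷ _ ∷ _) _ s₁ s₂

    insert-2341 : Occurs Is2341 (L ++ M ∷ R) →
      Occurs Is2341 (L ++ R) ⊎ ∃₂ λ a b → a ∷ b ∷ [] ⊆ L × a < b × ∃ (_∈ R)
    insert-2341 (t , s , p) with split L s
    insert-2341 (t , s , p) | without s′ = inj₁ (t , s′ , p)
    insert-2341 (t , s , is2341 p q r) | through [] _ s₁ s₂ with All-resp-⊆ s₂ R<
    ... | c<M ∷ _ = contradiction q (<-asym c<M)
    insert-2341 (t , s , is2341 p q r) | through (b ∷ []) (_ ∷ _ ∷ []) s₁ s₂ with All-resp-⊆ s₂ R<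
    ... | d<M ∷ _ = contradiction r (<-asym d<M)
    insert-2341 (t , s , is2341 p q r) | through (b ∷ c ∷ []) (a ∷ []) s₁ s₂ = inj₂ (b , c , s₁ , q , a , to∈ s₂)
    insert-2341 (t , s , is2341 p q r) | through (b ∷ c ∷ d ∷ []) _ s₁ s₂ with All-resp-⊆ s₁ L<
    ... | b<M ∷ _ = contradiction p (<-asym b<M)
    insert-2341 (t , s , ()) | through (_ ∷ _ ∷ _ ∷ _ ∷ []) _ s₁ s₂
    insert-2341 (t , s , ()) | through (_ ∷ _ ∷ _ ∷ _ ∷ _ ∷ _) _ s₁ s₂

    -- The 3 of 213 comes last, so the 2 and the 1 form a descent in L.
    insert-213 : Occurs (IsTau 0) (L ++ M ∷ R) →
      Occurs (IsTau 0) (L ++ R) ⊎ ∃₂ λ a b → a ∷ b ∷ [] ⊆ L × b < a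
    insert-213 (t , s , p) with split L s
    insert-213 (t , s , p) | without s′ = inj₁ (t , s′ , p)
    insert-213 (t , s , is213 p q) | through [] _ s₁ s₂ with All-resp-⊆ s₂ R<
    ... | _ ∷ c<M ∷ [] = contradiction q (<-asym c<M)
    insert-213 (t , s , is213 p q) | through (b ∷ []) (c ∷ []) s₁ s₂ with All-resp-⊆ s₁ L<
    ... | b<M ∷ [] = contradiction p (<-asym b<M)
    insert-213 (t , s , is213 p q) | through (a ∷ b ∷ []) [] s₁ s₂ = inj₂ (a , b , s₁ , p)
    insert-213 (t , s , ()) | through (_ ∷ _ ∷ _ ∷ []) _ s₁ s₂
    insert-213 (t , s , ()) | through (_ ∷ _ ∷ _ ∷ _ ∷ _) _ s₁ s₂

    -- Beyond 213 the largest letter of τ comes first, so everything after M in the occurrence is a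
    -- shorter τ inside R.
    insert-tau : ∀ {i} → Occurs (IsTau (suc i)) (L ++ M ∷ R) →
      Occurs (IsTau (suc i)) (L ++ R) ⊎ Occurs (IsTau i) R
    insert-tau (t , s , p) with split L s
    insert-tau (t , s , p) | without s′ = inj₁ (t , s′ , p)
    insert-tau (t , s , _ ∷ p) | through [] t₂ s₁ s₂ = inj₂ (t₂ , s₂ , p)
    insert-tau (t , s , t< ∷ p) | through (x ∷ t₁) t₂ s₁ s₂ with All-resp-⊆ s₁ L< | All.++⁻ʳ t₁ t<
    ... | x<M ∷ _ | M<x ∷ _ = contradiction x<M (<-asym M<x)

  -- Admissible positions of the maximum, for general i.

  Dominates : List ℕ → List ℕ → Set
  Dominates []      R = ⊤
  Dominates (x ∷ L) R = All (_< x) (L ++ R) × Dominates L R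

  dominates-> : ∀ {L R a b} → Dominates L R → a ∈ L → b ∈ R → b < a
  dominates-> {x ∷ L} (p , d) (here refl) b∈ = All.lookup p (∈-++⁺ʳ L b∈)
  dominates-> {x ∷ L} (p , d) (there a∈) b∈ = dominates-> d a∈ b∈

  dominates-decreasing : ∀ {L R a b} → Dominates L R → a ∷ b ∷ [] ⊆ L → b < a
  dominates-decreasing {x ∷ L} (p , d) (_ ∷ʳ s)   = dominates-decreasing d s
  dominates-decreasing {x ∷ L} (p , d) (refl ∷ s) = All.lookup p (∈-++⁺ˡ (to∈ s))

  dominates : ∀ L {R} → (∀ {a b} → a ∷ b ∷ [] ⊆ L → b < a) → (∀ {a b} → a ∈ L → b ∈ R → b < a) → Dominates L R
  dominates [] f g = tt
  dominates (x ∷ L) f g =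
    All.++⁺ (All.tabulate λ y∈ → f (refl ∷ from∈ y∈)) (All.tabulate λ y∈ → g (here refl) y∈) ,
    dominates L (f ∘ (x ∷ʳ_)) (g ∘ there)

  Unique-⊆ : ∀ {a b} {π : List ℕ} → Unique π → a ∷ b ∷ [] ⊆ π → a ≢ b
  Unique-⊆ (x≢ ∷ u) (_ ∷ʳ s)   = Unique-⊆ u s
  Unique-⊆ (x≢ ∷ u) (refl ∷ s) = All.lookup x≢ (to∈ s)

  pair-++ : ∀ {a b : ℕ} {L R} → a ∈ L → b ∈ R → a ∷ b ∷ [] ⊆ L ++ R
  pair-++ a∈ b∈ = ++⁺ (from∈ a∈) (from∈ b∈)

  module _ {i : ℕ} {L : List ℕ} {M : ℕ} {R : List ℕ} (L< : All (_< M) L) (R< : All (_< M) R) where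

    -- If a in L and b in R had a < b, then a M b would be 132; hence L lies above R. An ascent a <
    -- b in L would then make a b M d a 2341, with d in R as its 1. Distinctness rules out ties.
    avoids⇒dominates : ∀ {d} → d ∈ R → Unique (L ++ R) → Avoids i (L ++ M ∷ R) → Dominates L R
    avoids⇒dominates {d} d∈ u av = dominates L decr above
      where
      above : ∀ {a b} → a ∈ L → b ∈ R → b < a
      above {a} {b} a∈ b∈ with <-cmp b a
      ... | tri< b<a _ _ = b<a
      ... | tri≈ _ refl _ = contradiction refl (Unique-⊆ u (pair-++ a∈ b∈))
      ... | tri> _ _ a<b = contradiction
        (_ , ++⁺ (from∈ a∈) (refl ∷ from∈ b∈) , is132 a<b (All.lookup R< b∈)) (no132 av)

      decr : ∀ {a b} → a ∷ b ∷ [] ⊆ L → b < a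
      decr {a} {b} s with <-cmp b a
      ... | tri< b<a _ _ = b<a
      ... | tri≈ _ refl _ = contradiction refl (Unique-⊆ u (++⁺ʳ R s))
      ... | tri> _ _ a<b = contradiction
        (_ , ++⁺ s (refl ∷ from∈ d∈) ,
         is2341 (above (to∈ s) d∈) a<b (All.lookup L< (to∈ (⊆-trans (_ ∷ʳ ⊆-refl) s))))
        (no2341 av)

    -- Dominance is demanded only when R has a letter, so insertion at the end is covered too. The
    -- condition on τ is left to the caller because it depends on i and on the position.
    insert-avoids : (∀ {b} → b ∈ R → Dominates L R) → ¬ Occurs (IsTau i) (L ++ M ∷ R) → Avoids i (L ++ R) → Avoids i (L ++ M ∷ R)
    insert-avoids dom nτ av = avoids
      (λ o → case insert-132 L< R< o of λ where
        (inj₁ o′) → no132 av o′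
        (inj₂ (a , b , a∈ , b∈ , a<b)) → <-asym a<b (dominates-> (dom b∈) a∈ b∈))
      nτ
      (λ o → case insert-2341 L< R< o of λ where
        (inj₁ o′) → no2341 av o′
        (inj₂ (a , b , s , a<b , d , d∈)) → <-asym a<b (dominates-decreasing (dom d∈) s))

  -- A new τ starting at M leaves a shorter τ in R. As x exceeds all of R, x followed by that
  -- shorter τ already was a full τ, so an inner insertion creates no condition from τ.
  avoids-mid : ∀ {i x L M R d} → All (_< M) (x ∷ L) → All (_< M) R → d ∈ R → Unique (x ∷ L ++ R) →
    Avoids (suc i) (x ∷ L ++ M ∷ R) ⇔ (Dominates (x ∷ L) R × Avoids (suc i) (x ∷ L ++ R))
  avoids-mid {i} {x} {L} L< R< d∈ u = mk⇔
    (λ av → avoids⇒dominates L< R< d∈ u av , Avoids-anti (delete-⊆ (x ∷ L)) av)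
    (λ (dom , av) → insert-avoids L< R< (λ _ → dom)
      (λ o → case insert-tau L< R< o of λ where
        (inj₁ o′) → noTau av o′
        (inj₂ (t , s , p)) → noTau av
          (x ∷ t , refl ∷ ++⁺ˡ L s , All-resp-⊆ s (All.++⁻ʳ L (proj₁ dom)) ∷ p))
      av)

  occurs-[] : ∀ {i} → ¬ Occurs (IsTau i) []
  occurs-[] (_ , [] , ())

  -- With nothing to its right, M can be neither the 3 of 132, nor the 4 of 2341, nor the first
  -- letter of τ.
  avoids-snoc : ∀ {i L M} → All (_< M) L → Avoids (suc i) (L ++ M ∷ []) ⇔ Avoids (suc i) (L ++ [])
  avoids-snoc {L = L} L< = mk⇔ (Avoids-anti (delete-⊆ L)) λ av → insert-avoids L< [] (λ ())
    (λ o → case insert-tau L< [] o of λ where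
      (inj₁ o′) → noTau av o′
      (inj₂ o′) → occurs-[] o′)
    av

  -- M in front completes any shorter τ in R to a full one, while every full τ in R contains a
  -- shorter one. Neither 132 nor 2341 begins with its maximum.
  avoids-cons : ∀ {i M R} → All (_< M) R → Avoids (suc i) (M ∷ R) ⇔ Avoids i R
  avoids-cons {i} {M} {R} R< = mk⇔
    (λ av → avoids (no132 av ∘ Occurs-mono (M ∷ʳ ⊆-refl))
      (λ (t , s , p) → noTau av (M ∷ t , refl ∷ s , All-resp-⊆ s R< ∷ p))
      (no2341 av ∘ Occurs-mono (M ∷ʳ ⊆-refl)))
    (λ av → insert-avoids {L = []} [] R< (λ _ → tt)
      (λ o → case insert-tau [] R< o of λ where
        (inj₁ o′) → noTau av (drop-head o′)
        (inj₂ o′) → noTau av o′)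
      (avoids (no132 av) (noTau av ∘ drop-head) (no2341 av)))
    where
    drop-head : Occurs (IsTau (suc i)) R → Occurs (IsTau i) R
    drop-head (_ , s , _ ∷ p) = _ , ⊆-trans (_ ∷ʳ ⊆-refl) s , p

  -- Admissible positions of the maximum when τ is 213.

  avoids₀-cons : ∀ {M R} → All (_< M) R → Avoids 0 (M ∷ R) ⇔ Avoids 0 R
  avoids₀-cons R< = mk⇔ (Avoids-anti (_ ∷ʳ ⊆-refl)) λ av → insert-avoids {L = []} [] R< (λ _ → tt)
    (λ o → case insert-213 [] R< o of λ where
      (inj₁ o′) → noTau av o′
      (inj₂ (_ , _ , () , _)))
    av

  avoids₀-second : ∀ {x M R d} → x < M → All (_< M) R → d ∈ R → Unique (x ∷ R) →
    Avoids 0 (x ∷ M ∷ R) ⇔ (All (_< x) R × Avoids 0 (x ∷ R))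
  avoids₀-second {x} x< R< d∈ u = mk⇔
    (λ av → proj₁ (avoids⇒dominates (x< ∷ []) R< d∈ u av) , Avoids-anti (delete-⊆ (x ∷ [])) av)
    (λ (R<x , av) → insert-avoids (x< ∷ []) R< (λ _ → R<x , tt)
      (λ o → case insert-213 (x< ∷ []) R< o of λ where
        (inj₁ o′) → noTau av o′
        (inj₂ (_ , _ , (_ ∷ʳ ()) , _))
        (inj₂ (_ , _ , (_ ∷ ()) , _)))
      av)

  -- Dominance forces x > y, and then x y M is 213.
  avoids₀-third : ∀ {x y L M R d} → All (_< M) (x ∷ y ∷ L) → All (_< M) R → d ∈ R →
    Unique (x ∷ y ∷ L ++ R) → ¬ Avoids 0 (x ∷ y ∷ L ++ M ∷ R)
  avoids₀-third {L = L} L<@(x< ∷ y< ∷ _) R< d∈ u av =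
    noTau av (_ , refl ∷ refl ∷ ++⁺ˡ L (refl ∷ minimum _) , is213 (All.head (proj₁ dom)) x<)
    where dom = avoids⇒dominates L< R< d∈ u av

  Increasing : List ℕ → Set
  Increasing = AllPairs _<_

  increasing-⊆ : ∀ {a b π} → Increasing π → a ∷ b ∷ [] ⊆ π → a < b
  increasing-⊆ (x< ∷ inc) (_ ∷ʳ s)   = increasing-⊆ inc s
  increasing-⊆ (x< ∷ inc) (refl ∷ s) = All.lookup x< (to∈ s)

  increasing : ∀ {π} → (∀ {a b} → a ∷ b ∷ [] ⊆ π → a < b) → Increasing π
  increasing {[]}    f = []
  increasing {x ∷ π} f = All.tabulate (λ y∈ → f (refl ∷ from∈ y∈)) ∷ increasing (f ∘ (x ∷ʳ_))

  increasing⇒avoids : ∀ {π} → Increasing π → Avoids 0 π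
  increasing⇒avoids inc = avoids
    (λ { (_ , s , is132 p q) → <-asym q (increasing-⊆ inc (⊆-trans (_ ∷ʳ ⊆-refl) s)) })
    (λ { (_ , s , is213 p q) → <-asym p (increasing-⊆ inc (⊆-trans (refl ∷ refl ∷ minimum _) s)) })
    (λ { (_ , s , is2341 p q r) → <-asym p (increasing-⊆ inc (⊆-trans (refl ∷ _ ∷ʳ _ ∷ʳ ⊆-refl) s)) })

  increasing-snoc : ∀ {L M} → All (_< M) L → Increasing (L ++ M ∷ []) ⇔ Increasing (L ++ [])
  increasing-snoc {L} {M} L< = mk⇔
    (λ inc → increasing (λ s → increasing-⊆ inc (⊆-trans s (delete-⊆ L))))
    (λ inc → AllPairs.++⁺ (subst Increasing (++-identityʳ L) inc) ([] ∷ []) (All.map (_∷ []) L<))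

  increasing-mid : ∀ L {M y R} → y < M → ¬ Increasing (L ++ M ∷ y ∷ R)
  increasing-mid L y<M inc = <-asym y<M (increasing-⊆ inc (++⁺ˡ L (refl ∷ refl ∷ minimum _)))

  -- A final M turns every descent of L into 213; conversely each of the three patterns contains a
  -- descent, so an increasing word avoids them all.
  avoids₀-snoc : ∀ {L M} → All (_< M) L → Unique (L ++ []) → Avoids 0 (L ++ M ∷ []) ⇔ Increasing (L ++ [])
  avoids₀-snoc {L} {M} L< u = mk⇔
    (λ av → increasing (λ s → ascent av (subst (_ ⊆_) (++-identityʳ L) s)))
    (increasing⇒avoids ∘ from (increasing-snoc L<))
    where
    ascent : ∀ {a b} → Avoids 0 (L ++ M ∷ []) → a ∷ b ∷ [] ⊆ L → a < b
    ascent {a} {b} av s with <-cmp a b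
    ... | tri< a<b _ _ = a<b
    ... | tri≈ _ refl _ = contradiction refl (Unique-⊆ u (++⁺ʳ [] s))
    ... | tri> _ _ b<a = contradiction
      (_ , ++⁺ s ⊆-refl , is213 b<a (All.lookup L< (to∈ s))) (noTau av)

  -- Indicators and sums over lists.

  𝟙 : ∀ {P : Set} → Dec P → ℕ
  𝟙 d = if does d then 1 else 0

  𝟙-true : ∀ {P : Set} (d : Dec P) → P → 𝟙 d ≡ 1
  𝟙-true d p = cong (if_then 1 else 0) (dec-true d p)

  𝟙-false : ∀ {P : Set} (d : Dec P) → ¬ P → 𝟙 d ≡ 0
  𝟙-false d p = cong (if_then 1 else 0) (dec-false d p)

  𝟙-cong : ∀ {P Q : Set} (d : Dec P) (e : Dec Q) → P ⇔ Q → 𝟙 d ≡ 𝟙 e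
  𝟙-cong d (yes q) eq = 𝟙-true d (from eq q)
  𝟙-cong d (no ¬q) eq = 𝟙-false d (¬q ∘ to eq)

  𝟙-× : ∀ {P Q R : Set} (d : Dec P) (e : Dec Q) (f : Dec R) → P ⇔ (Q × R) → 𝟙 d ≡ 𝟙 e * 𝟙 f
  𝟙-× d (yes q) (yes r) eq = 𝟙-true d (from eq (q , r))
  𝟙-× d (yes q) (no ¬r) eq = 𝟙-false d (¬r ∘ proj₂ ∘ to eq)
  𝟙-× d (no ¬q) f       eq = 𝟙-false d (¬q ∘ proj₁ ∘ to eq)

  ∑ : {A : Set} → (A → ℕ) → List A → ℕ
  ∑ f xs = sum (map f xs)

  ∑-cong : {A : Set} {f g : A → ℕ} {xs : List A} → All (λ x → f x ≡ g x) xs → ∑ f xs ≡ ∑ g xs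
  ∑-cong []       = refl
  ∑-cong (p ∷ ps) = cong₂ _+_ p (∑-cong ps)

  ∑-zero : {A : Set} {f : A → ℕ} {xs : List A} → All (λ x → f x ≡ 0) xs → ∑ f xs ≡ 0
  ∑-zero []       = refl
  ∑-zero (p ∷ ps) = cong₂ _+_ p (∑-zero ps)

  ∑-map : {A B : Set} (f : B → ℕ) (g : A → B) (xs : List A) → ∑ f (map g xs) ≡ ∑ (f ∘ g) xs
  ∑-map f g []       = refl
  ∑-map f g (x ∷ xs) = cong (f (g x) +_) (∑-map f g xs)

  ∑-++ : {A : Set} (f : A → ℕ) (xs ys : List A) → ∑ f (xs ++ ys) ≡ ∑ f xs + ∑ f ys
  ∑-++ f []       ys = refl
  ∑-++ f (x ∷ xs) ys = trans (cong (f x +_) (∑-++ f xs ys)) (sym (+-assoc (f x) _ _))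

  ∑-concatMap : {A B : Set} (f : B → ℕ) (g : A → List B) (xs : List A) →
    ∑ f (concatMap g xs) ≡ ∑ (λ x → ∑ f (g x)) xs
  ∑-concatMap f g []       = refl
  ∑-concatMap f g (x ∷ xs) =
    trans (∑-++ f (g x) (concatMap g xs)) (cong (∑ f (g x) +_) (∑-concatMap f g xs))

  ∑-+ : {A : Set} (f g : A → ℕ) (xs : List A) → ∑ (λ x → f x + g x) xs ≡ ∑ f xs + ∑ g xs
  ∑-+ f g []       = refl
  ∑-+ f g (x ∷ xs) = trans (cong (f x + g x +_) (∑-+ f g xs))
    (solve 4 (λ a b c d → a :+ b :+ (c :+ d) := a :+ c :+ (b :+ d)) refl (f x) (g x) (∑ f xs) (∑ g xs))
    where open +-*-Solver

  length-filter : {A : Set} {P : A → Set} (P? : ∀ x → Dec (P x)) (xs : List A) →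
    length (filter P? xs) ≡ ∑ (𝟙 ∘ P?) xs
  length-filter P? [] = refl
  length-filter P? (x ∷ xs) with P? x
  ... | yes _ = cong suc (length-filter P? xs)
  ... | no  _ = length-filter P? xs

  -- Permutations grouped by deletion of their maximum.

  record Valid (n : ℕ) (π : List ℕ) : Set where
    constructor valid
    field
      size     : length π ≡ n
      bounded  : All (_< suc n) π
      distinct : Unique π

  insertions-↭ : ∀ M ρ → All (_↭ M ∷ ρ) (insertions M ρ)
  insertions-↭ M []      = ↭-refl ∷ []
  insertions-↭ M (y ∷ ρ) =
    ↭-refl ∷ All.map⁺ (All.map (λ p → ↭-trans (prep y p) (swap y M ↭-refl)) (insertions-↭ M ρ))

  Valid-↭ : ∀ {n π ρ} → π ↭ ρ → Valid n π → Valid n ρ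
  Valid-↭ p (valid s b d) = valid (trans (sym (↭-length p)) s) (All-resp-↭ p b) (Unique-resp-↭ p d)
    where Unique-resp-↭ = Perm.AllPairs-resp-↭ (setoid ℕ) (_∘ sym) (resp₂ _≢_) ∘ ↭⇒↭ₛ

  Valid-cons : ∀ {n ρ} → Valid n ρ → Valid (suc n) (suc n ∷ ρ)
  Valid-cons (valid s b d) =
    valid (cong suc s) (≤-refl ∷ All.map m<n⇒m<1+n b) (All.map (λ x< → <⇒≢ x< ∘ sym) b ∷ d)

  Valid-S : ∀ n → All (Valid n) (S n)
  Valid-S zero    = valid refl [] [] ∷ []
  Valid-S (suc n) = All.concat⁺ (All.map⁺ (All.map
    (λ v → All.map (λ p → Valid-↭ (↭-sym p) (Valid-cons v)) (insertions-↭ (suc n) _)) (Valid-S n)))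

  -- Sizes start at 2 so that the word receiving the maximum is nonempty and its first and last
  -- positions differ.
  ∑-S : ∀ (f g : List ℕ → ℕ) n → (∀ y ρ → Valid (suc n) (y ∷ ρ) → ∑ f (insertions (2 + n) (y ∷ ρ)) ≡ g (y ∷ ρ)) →
    ∑ f (S (2 + n)) ≡ ∑ g (S (suc n))
  ∑-S f g n h = trans (∑-concatMap f (insertions (2 + n)) (S (suc n)))
    (∑-cong (All.map (λ { {[]} (valid () _ _) ; {y ∷ ρ} v → h y ρ v }) (Valid-S (suc n))))

  -- Counting admissible positions.

  Avoids? : ∀ i π → Dec (Avoids i π)
  Avoids? i π = map′ (avoidsAll⁻ i π) (avoidsAll⁺ i π) (T? _)

  Dominates? : ∀ L R → Dec (Dominates L R)
  Dominates? []      R = yes tt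
  Dominates? (x ∷ L) R = All.all? (_<? x) (L ++ R) ×-dec Dominates? L R

  Increasing? : ∀ π → Dec (Increasing π)
  Increasing? = AllPairs.allPairs? _<?_

  -- Counts the cuts from the one between L and R rightwards, except the end of the word, at which
  -- dominance holds. `sites` starts after the first letter and so counts inner positions only.
  splits : List ℕ → List ℕ → ℕ
  splits L []      = 0
  splits L (y ∷ R) = 𝟙 (Dominates? L (y ∷ R)) + splits (L ++ y ∷ []) R

  sites : List ℕ → ℕ
  sites []      = 0
  sites (x ∷ R) = splits (x ∷ []) R

  -- What x must exceed is the whole of `L ++ R`, the same at every cut, so one indicator factors
  -- out of all terms.
  splits-cons : ∀ x L R → splits (x ∷ L) R ≡ 𝟙 (All.all? (_<? x) (L ++ R)) * splits L R
  splits-cons x L []      = sym (*-zeroʳ (𝟙 (All.all? (_<? x) (L ++ []))))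
  splits-cons x L (y ∷ R) = begin
    𝟙 (Dominates? (x ∷ L) (y ∷ R)) + splits (x ∷ L ++ y ∷ []) R
      ≡⟨ cong₂ _+_ (𝟙-× (Dominates? (x ∷ L) (y ∷ R)) below? (Dominates? L (y ∷ R)) (mk⇔ (λ z → z) (λ z → z)))
           (splits-cons x (L ++ y ∷ []) R) ⟩
    𝟙 below? * 𝟙 (Dominates? L (y ∷ R)) + 𝟙 (All.all? (_<? x) ((L ++ y ∷ []) ++ R)) * splits (L ++ y ∷ []) R
      ≡⟨ cong (λ π → 𝟙 below? * 𝟙 (Dominates? L (y ∷ R)) + 𝟙 (All.all? (_<? x) π) * splits (L ++ y ∷ []) R)
           (++-assoc L (y ∷ []) R) ⟩
    𝟙 below? * 𝟙 (Dominates? L (y ∷ R)) + 𝟙 below? * splits (L ++ y ∷ []) R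
      ≡⟨ *-distribˡ-+ (𝟙 below?) _ _ ⟨
    𝟙 below? * (𝟙 (Dominates? L (y ∷ R)) + splits (L ++ y ∷ []) R) ∎
    where
    open ≡-Reasoning
    below? = All.all? (_<? x) (L ++ y ∷ R)

  -- The added site is the gap right after M; all sites of the old word persist because M exceeds
  -- everything.
  sites-cons : ∀ {M y R} → All (_< M) (y ∷ R) → sites (M ∷ y ∷ R) ≡ suc (sites (y ∷ R))
  sites-cons {M} {y} {R} R< = cong₂ _+_ (𝟙-true (Dominates? (M ∷ []) (y ∷ R)) (R< , tt))
    (trans (splits-cons M (y ∷ []) R) (trans (cong (_* sites (y ∷ R)) (𝟙-true (All.all? (_<? M) (y ∷ R)) R<)) (*-identityˡ _)))

  not-below : ∀ {M y R π} → y < M → π ↭ M ∷ R → ¬ All (_< y) π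
  not-below y<M p π< = <-asym y<M (All.lookup π< (∈-resp-↭ (↭-sym p) (here refl)))

  -- Every site requires the first letter to exceed all the others, which M prevents.
  sites-insert : ∀ {M y R π} → y < M → π ↭ M ∷ R → sites (y ∷ π) ≡ 0
  sites-insert {y = y} {π = π} y<M p = trans (splits-cons y [] π)
    (cong (_* splits [] π) (𝟙-false (All.all? (_<? y) π) (not-below y<M p)))

  -- The prefix is general so that it can grow during the induction on R. `suc` accounts for the
  -- last position, given by `avoids-snoc`; each gap before a letter of R is governed by
  -- `avoids-mid`.
  ∑-insert : ∀ {i M} x L R → All (_< M) (x ∷ L ++ R) → Unique (x ∷ L ++ R) →
    ∑ (λ π → 𝟙 (Avoids? (suc i) (x ∷ L ++ π))) (insertions M R)
      ≡ 𝟙 (Avoids? (suc i) (x ∷ L ++ R)) * suc (splits (x ∷ L) R)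
  ∑-insert {i} {M} x L [] <M u = begin
    𝟙 (Avoids? (suc i) (x ∷ L ++ M ∷ [])) + 0
      ≡⟨ cong (_+ 0) (𝟙-cong (Avoids? (suc i) (x ∷ L ++ M ∷ [])) (Avoids? (suc i) (x ∷ L ++ []))
           (avoids-snoc (All.++⁻ˡ (x ∷ L) <M))) ⟩
    𝟙 (Avoids? (suc i) (x ∷ L ++ [])) + 0
      ≡⟨ solve 1 (λ a → a :+ con 0 := a :* con 1) refl (𝟙 (Avoids? (suc i) (x ∷ L ++ []))) ⟩
    𝟙 (Avoids? (suc i) (x ∷ L ++ [])) * 1 ∎
    where
    open ≡-Reasoning
    open +-*-Solver
  ∑-insert {i} {M} x L (y ∷ R) <M u = begin
    𝟙 (Avoids? (suc i) (x ∷ L ++ M ∷ y ∷ R))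
      + ∑ (λ π → 𝟙 (Avoids? (suc i) (x ∷ L ++ π))) (map (y ∷_) (insertions M R))
      ≡⟨ cong₂ _+_
           (𝟙-× (Avoids? (suc i) (x ∷ L ++ M ∷ y ∷ R)) (Dominates? (x ∷ L) (y ∷ R)) (Avoids? (suc i) (x ∷ L ++ y ∷ R))
             (avoids-mid (All.++⁻ˡ (x ∷ L) <M) (All.++⁻ʳ (x ∷ L) <M) (here refl) u))
           (trans (∑-map _ (y ∷_) (insertions M R))
             (∑-cong {xs = insertions M R} (All.tabulate λ {π} _ → cong (𝟙 ∘ Avoids? (suc i) ∘ (x ∷_)) (sym (++-assoc L (y ∷ []) π))))) ⟩
    𝟙 (Dominates? (x ∷ L) (y ∷ R)) * 𝟙 (Avoids? (suc i) (x ∷ L ++ y ∷ R))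
      + ∑ (λ π → 𝟙 (Avoids? (suc i) (x ∷ (L ++ y ∷ []) ++ π))) (insertions M R)
      ≡⟨ cong (𝟙 (Dominates? (x ∷ L) (y ∷ R)) * 𝟙 (Avoids? (suc i) (x ∷ L ++ y ∷ R)) +_)
           (∑-insert x (L ++ y ∷ []) R (subst (All (_< M) ∘ (x ∷_)) (sym (++-assoc L (y ∷ []) R)) <M)
             (subst (Unique ∘ (x ∷_)) (sym (++-assoc L (y ∷ []) R)) u)) ⟩
    𝟙 (Dominates? (x ∷ L) (y ∷ R)) * 𝟙 (Avoids? (suc i) (x ∷ L ++ y ∷ R))
      + 𝟙 (Avoids? (suc i) (x ∷ (L ++ y ∷ []) ++ R)) * suc (splits (x ∷ L ++ y ∷ []) R)
      ≡⟨ cong (λ π → 𝟙 (Dominates? (x ∷ L) (y ∷ R)) * 𝟙 (Avoids? (suc i) (x ∷ L ++ y ∷ R))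
                       + 𝟙 (Avoids? (suc i) (x ∷ π)) * suc (splits (x ∷ L ++ y ∷ []) R))
           (++-assoc L (y ∷ []) R) ⟩
    𝟙 (Dominates? (x ∷ L) (y ∷ R)) * 𝟙 (Avoids? (suc i) (x ∷ L ++ y ∷ R))
      + 𝟙 (Avoids? (suc i) (x ∷ L ++ y ∷ R)) * suc (splits (x ∷ L ++ y ∷ []) R)
      ≡⟨ solve 3 (λ d a s → d :* a :+ a :* (con 1 :+ s) := a :* (con 1 :+ (d :+ s))) refl
           (𝟙 (Dominates? (x ∷ L) (y ∷ R))) (𝟙 (Avoids? (suc i) (x ∷ L ++ y ∷ R))) (splits (x ∷ L ++ y ∷ []) R) ⟩
    𝟙 (Avoids? (suc i) (x ∷ L ++ y ∷ R)) * suc (splits (x ∷ L) (y ∷ R)) ∎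
    where
    open ≡-Reasoning
    open +-*-Solver

  ∑-insert-end : ∀ M (f : List ℕ → ℕ) R → (∀ R₁ y R₂ → R ≡ R₁ ++ y ∷ R₂ → f (R₁ ++ M ∷ y ∷ R₂) ≡ 0) →
    ∑ f (insertions M R) ≡ f (R ++ M ∷ [])
  ∑-insert-end M f []      h = +-identityʳ _
  ∑-insert-end M f (y ∷ R) h = cong₂ _+_ (h [] y R refl)
    (trans (∑-map f (y ∷_) (insertions M R))
      (∑-insert-end M (f ∘ (y ∷_)) R (λ R₁ z R₂ eq → h (y ∷ R₁) z R₂ (cong (y ∷_) eq))))

  ∑-insert-increasing : ∀ {M} R → All (_< M) R → ∑ (𝟙 ∘ Increasing?) (insertions M R) ≡ 𝟙 (Increasing? R)
  ∑-insert-increasing {M} R <M = trans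
    (∑-insert-end M (𝟙 ∘ Increasing?) R λ { R₁ y R₂ refl → 𝟙-false (Increasing? (R₁ ++ M ∷ y ∷ R₂))
      (increasing-mid R₁ (All.head (All.++⁻ʳ R₁ <M))) })
    (𝟙-cong (Increasing? (R ++ M ∷ [])) (Increasing? R)
      (subst (λ ρ → Increasing (R ++ M ∷ []) ⇔ Increasing ρ) (++-identityʳ R) (increasing-snoc <M)))

  avoids₀-end : ∀ {M} R → All (_< M) R → Unique R → 𝟙 (Avoids? 0 (R ++ M ∷ [])) ≡ 𝟙 (Increasing? R)
  avoids₀-end {M} R <M u = 𝟙-cong (Avoids? 0 (R ++ M ∷ [])) (Increasing? R)
    (subst (λ ρ → Avoids 0 (R ++ M ∷ []) ⇔ Increasing ρ) (++-identityʳ R)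
      (avoids₀-snoc <M (subst Unique (sym (++-identityʳ R)) u)))

  -- Indicates whether the second position is admissible for 213. A one-letter word gets 0 because
  -- its second position is the last one, counted by the `Increasing?` term.
  headMax : List ℕ → ℕ
  headMax (x ∷ y ∷ R) = 𝟙 (All.all? (_<? x) (y ∷ R))
  headMax _           = 0

  headMax-insert : ∀ {M y R π} → y < M → π ↭ M ∷ R → headMax (y ∷ π) ≡ 0
  headMax-insert {π = []}    _   _ = refl
  headMax-insert {y = y} {π = z ∷ π} y<M p = 𝟙-false (All.all? (_<? y) (z ∷ π)) (not-below y<M p)

  ∑-insert₀ : ∀ {M} x R → All (_< M) (x ∷ R) → Unique (x ∷ R) →
    ∑ (λ π → 𝟙 (Avoids? 0 (x ∷ π))) (insertions M R)
      ≡ 𝟙 (Increasing? (x ∷ R)) + 𝟙 (Avoids? 0 (x ∷ R)) * headMax (x ∷ R)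
  ∑-insert₀ {M} x [] <M u =
    cong₂ _+_ (avoids₀-end (x ∷ []) <M u) (sym (*-zeroʳ (𝟙 (Avoids? 0 (x ∷ [])))))
  ∑-insert₀ {M} x (y ∷ R) <M@(x< ∷ R<@(y< ∷ R′<)) u = begin
    𝟙 (Avoids? 0 (x ∷ M ∷ y ∷ R)) + ∑ (λ π → 𝟙 (Avoids? 0 (x ∷ π))) (map (y ∷_) (insertions M R))
      ≡⟨ cong₂ _+_
           (𝟙-× (Avoids? 0 (x ∷ M ∷ y ∷ R)) (All.all? (_<? x) (y ∷ R)) (Avoids? 0 (x ∷ y ∷ R))
             (avoids₀-second x< R< (here refl) u))
           (trans (∑-map _ (y ∷_) (insertions M R))
             (∑-insert-end M (λ π → 𝟙 (Avoids? 0 (x ∷ y ∷ π))) R λ { R₁ z R₂ refl →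
               𝟙-false (Avoids? 0 (x ∷ y ∷ R₁ ++ M ∷ z ∷ R₂))
                 (avoids₀-third (x< ∷ y< ∷ All.++⁻ˡ R₁ R′<) (All.++⁻ʳ R₁ R′<) (here refl) u) })) ⟩
    headMax (x ∷ y ∷ R) * 𝟙 (Avoids? 0 (x ∷ y ∷ R)) + 𝟙 (Avoids? 0 (x ∷ y ∷ R ++ M ∷ []))
      ≡⟨ cong₂ _+_ (*-comm (headMax (x ∷ y ∷ R)) _) (avoids₀-end (x ∷ y ∷ R) <M u) ⟩
    𝟙 (Avoids? 0 (x ∷ y ∷ R)) * headMax (x ∷ y ∷ R) + 𝟙 (Increasing? (x ∷ y ∷ R))
      ≡⟨ +-comm _ (𝟙 (Increasing? (x ∷ y ∷ R))) ⟩
    𝟙 (Increasing? (x ∷ y ∷ R)) + 𝟙 (Avoids? 0 (x ∷ y ∷ R)) * headMax (x ∷ y ∷ R) ∎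
    where open ≡-Reasoning

  -- The recurrences for `φ` and `ψ`.

  φ : ℕ → ℕ → ℕ
  φ i n = ∑ (𝟙 ∘ Avoids? i) (S n)

  weight : ℕ → List ℕ → ℕ
  weight i π = 𝟙 (Avoids? i π) * sites π

  ψ : ℕ → ℕ → ℕ
  ψ i n = ∑ (weight i) (S n)

  countAvoid-φ : ∀ i n → countAvoid (patterns i) n ≡ φ i n
  countAvoid-φ i n = length-filter (λ π → T? (avoidsAll (patterns i) π)) (S n)

  φ-suc : ∀ i n → φ (suc i) (2 + n) ≡ φ i (1 + n) + φ (suc i) (1 + n) + ψ (suc i) (1 + n)
  φ-suc i n = begin
    φ (suc i) (2 + n)
      ≡⟨ ∑-S (𝟙 ∘ Avoids? (suc i)) (λ ρ → 𝟙 (Avoids? i ρ) + 𝟙 (Avoids? (suc i) ρ) + weight (suc i) ρ) n step ⟩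
    ∑ (λ ρ → 𝟙 (Avoids? i ρ) + 𝟙 (Avoids? (suc i) ρ) + weight (suc i) ρ) (S (1 + n))
      ≡⟨ ∑-+ (λ ρ → 𝟙 (Avoids? i ρ) + 𝟙 (Avoids? (suc i) ρ)) (weight (suc i)) (S (1 + n)) ⟩
    ∑ (λ ρ → 𝟙 (Avoids? i ρ) + 𝟙 (Avoids? (suc i) ρ)) (S (1 + n)) + ψ (suc i) (1 + n)
      ≡⟨ cong (_+ ψ (suc i) (1 + n)) (∑-+ (𝟙 ∘ Avoids? i) (𝟙 ∘ Avoids? (suc i)) (S (1 + n))) ⟩
    φ i (1 + n) + φ (suc i) (1 + n) + ψ (suc i) (1 + n) ∎
    where
    open ≡-Reasoning
    step : ∀ y ρ → Valid (suc n) (y ∷ ρ) → ∑ (𝟙 ∘ Avoids? (suc i)) (insertions (2 + n) (y ∷ ρ))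
      ≡ 𝟙 (Avoids? i (y ∷ ρ)) + 𝟙 (Avoids? (suc i) (y ∷ ρ)) + weight (suc i) (y ∷ ρ)
    step y ρ (valid _ b d) = trans
      (cong₂ _+_ (𝟙-cong (Avoids? (suc i) (2 + n ∷ y ∷ ρ)) (Avoids? i (y ∷ ρ)) (avoids-cons b))
        (trans (∑-map _ (y ∷_) (insertions (2 + n) ρ)) (∑-insert y [] ρ b d)))
      (trans (cong (𝟙 (Avoids? i (y ∷ ρ)) +_) (*-suc (𝟙 (Avoids? (suc i) (y ∷ ρ))) (sites (y ∷ ρ))))
        (sym (+-assoc (𝟙 (Avoids? i (y ∷ ρ))) _ _)))

  -- Serves for `sites` and `headMax`, which both vanish unless the maximum stands first.
  insert-front : ∀ {M} (f g : List ℕ → ℕ) y ρ → All (_< M) (y ∷ ρ) →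
    (∀ {π} → y < M → π ↭ M ∷ ρ → g (y ∷ π) ≡ 0) →
    ∑ (λ π → f π * g π) (insertions M (y ∷ ρ)) ≡ f (M ∷ y ∷ ρ) * g (M ∷ y ∷ ρ)
  insert-front {M} f g y ρ (y< ∷ _) h = trans
    (cong (f (M ∷ y ∷ ρ) * g (M ∷ y ∷ ρ) +_) (trans (∑-map _ (y ∷_) (insertions M ρ))
      (∑-zero (All.map (λ {π} p → trans (cong (f (y ∷ π) *_) (h y< p)) (*-zeroʳ (f (y ∷ π)))) (insertions-↭ M ρ)))))
    (+-identityʳ _)

  -- Only words with M in front have sites, one more than after deleting M. The parameter j is what
  -- remains of i after that deletion: one less by `avoids-cons`, or still 0 by `avoids₀-cons`.
  ψ-step : ∀ {i j} n → (∀ {M R} → All (_< M) R → Avoids i (M ∷ R) ⇔ Avoids j R) →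
    ψ i (2 + n) ≡ φ j (1 + n) + ψ j (1 + n)
  ψ-step {i} {j} n cons = trans
    (∑-S (weight i) (λ ρ → 𝟙 (Avoids? j ρ) + weight j ρ) n step)
    (∑-+ (𝟙 ∘ Avoids? j) (weight j) (S (1 + n)))
    where
    step : ∀ y ρ → Valid (suc n) (y ∷ ρ) →
      ∑ (weight i) (insertions (2 + n) (y ∷ ρ)) ≡ 𝟙 (Avoids? j (y ∷ ρ)) + weight j (y ∷ ρ)
    step y ρ (valid _ b _) = trans
      (insert-front (𝟙 ∘ Avoids? i) sites y ρ b sites-insert)
      (trans (cong₂ _*_ (𝟙-cong (Avoids? i (2 + n ∷ y ∷ ρ)) (Avoids? j (y ∷ ρ)) (cons b)) (sites-cons b))
        (*-suc (𝟙 (Avoids? j (y ∷ ρ))) (sites (y ∷ ρ))))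

  ψ-suc : ∀ i n → ψ (suc i) (2 + n) ≡ φ i (1 + n) + ψ i (1 + n)
  ψ-suc i n = ψ-step n avoids-cons

  ψ-zero : ∀ n → ψ 0 (2 + n) ≡ φ 0 (1 + n) + ψ 0 (1 + n)
  ψ-zero n = ψ-step n avoids₀-cons

  ∑-increasing : ∀ n → ∑ (𝟙 ∘ Increasing?) (S n) ≡ 1
  ∑-increasing zero    = refl
  ∑-increasing (suc n) = trans (∑-concatMap (𝟙 ∘ Increasing?) (insertions (suc n)) (S n))
    (trans (∑-cong (All.map (λ {ρ} v → ∑-insert-increasing ρ (Valid.bounded v)) (Valid-S n))) (∑-increasing n))

  ∑-headMax : ∀ n → ∑ (λ π → 𝟙 (Avoids? 0 π) * headMax π) (S (2 + n)) ≡ φ 0 (1 + n)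
  ∑-headMax n = ∑-S (λ π → 𝟙 (Avoids? 0 π) * headMax π) (𝟙 ∘ Avoids? 0) n λ y ρ (valid _ b _) → trans
    (insert-front (𝟙 ∘ Avoids? 0) headMax y ρ b headMax-insert)
    (trans (cong₂ _*_ (𝟙-cong (Avoids? 0 (2 + n ∷ y ∷ ρ)) (Avoids? 0 (y ∷ ρ)) (avoids₀-cons b))
        (𝟙-true (All.all? (_<? 2 + n) (y ∷ ρ)) b))
      (*-identityʳ _))

  -- The maximum may always go first, and last only after the increasing word. It may go second
  -- before another letter only if the word starts with its own maximum; deleting that one gives
  -- `φ 0 (1 + n)`.
  φ-zero : ∀ n → φ 0 (3 + n) ≡ φ 0 (2 + n) + (1 + φ 0 (1 + n))
  φ-zero n = begin
    φ 0 (3 + n)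
      ≡⟨ ∑-S (𝟙 ∘ Avoids? 0) (λ ρ → 𝟙 (Avoids? 0 ρ) + (𝟙 (Increasing? ρ) + top ρ)) (1 + n) step ⟩
    ∑ (λ ρ → 𝟙 (Avoids? 0 ρ) + (𝟙 (Increasing? ρ) + top ρ)) (S (2 + n))
      ≡⟨ ∑-+ (𝟙 ∘ Avoids? 0) _ (S (2 + n)) ⟩
    φ 0 (2 + n) + ∑ (λ ρ → 𝟙 (Increasing? ρ) + top ρ) (S (2 + n))
      ≡⟨ cong (φ 0 (2 + n) +_) (∑-+ (𝟙 ∘ Increasing?) top (S (2 + n))) ⟩
    φ 0 (2 + n) + (∑ (𝟙 ∘ Increasing?) (S (2 + n)) + ∑ top (S (2 + n)))
      ≡⟨ cong (φ 0 (2 + n) +_) (cong₂ _+_ (∑-increasing (2 + n)) (∑-headMax n)) ⟩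
    φ 0 (2 + n) + (1 + φ 0 (1 + n)) ∎
    where
    open ≡-Reasoning
    top : List ℕ → ℕ
    top ρ = 𝟙 (Avoids? 0 ρ) * headMax ρ
    step : ∀ y ρ → Valid (2 + n) (y ∷ ρ) → ∑ (𝟙 ∘ Avoids? 0) (insertions (3 + n) (y ∷ ρ))
      ≡ 𝟙 (Avoids? 0 (y ∷ ρ)) + (𝟙 (Increasing? (y ∷ ρ)) + top (y ∷ ρ))
    step y ρ (valid _ b d) = cong₂ _+_
      (𝟙-cong (Avoids? 0 (3 + n ∷ y ∷ ρ)) (Avoids? 0 (y ∷ ρ)) (avoids₀-cons b))
      (trans (∑-map _ (y ∷_) (insertions (3 + n) ρ)) (∑-insert₀ y ρ b d))

open Counting using (φ; ψ; φ-suc; φ-zero; ψ-suc; ψ-zero; countAvoid-φ)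

open import Data.Nat using (ℕ; _≤_; _∸_)
open import Data.Integer using (ℤ; +_)
open import Data.Rational using (ℚ; _+_; _*_; 0ℚ)
open import Data.List using (List; []; _∷_; _++_; length)
open import Data.Product using (Σ; _×_)
open import Relation.Nullary using (¬_)
open import Relation.Binary.PropositionalEquality using (_≡_)

import Data.Integer.Properties as ℤ
open import Data.Integer as ℤ using (-[1+_])
open import Data.List using (map; zipWith)
open import Data.List.Properties using (length-map; length-zipWith; length-++)
import Data.Nat.Properties as ℕ
open import Data.Nat as ℕ using (zero; suc; s≤s; z≤n)
open import Data.Product using (∃; ∃₂; _,_)
open import Data.Rational using (-_; _-_; 1ℚ; ½; toℚᵘ; 1/_; ≢-nonZero)
open import Data.Rational.Properties
open import Data.Rational.Solver using (module +-*-Solver)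
import Data.Rational.Unnormalised.Properties as ℚᵘ
open import Data.Rational.Unnormalised as ℚᵘ using (mkℚᵘ; *≡*)
open import Function using (_∘_)
open import Relation.Binary.PropositionalEquality using (_≢_; refl; sym; trans; cong; cong₂; subst; module ≡-Reasoning)
open +-*-Solver
open ≡-Reasoning

-- Natural numbers inside the rationals.

ι : ℕ → ℚ
ι n = ℤtoℚ (+ n)

toℚᵘ-ι : ∀ n → toℚᵘ (ι n) ℚᵘ.≃ mkℚᵘ (+ n) 0
toℚᵘ-ι n = toℚᵘ-fromℚᵘ (mkℚᵘ (+ n) 0)

-- Normalisation blocks computation on variables, so the identity is checked on unnormalised
-- fractions of denominator 1.
ι-+ : ∀ m n → ι (m ℕ.+ n) ≡ ι m + ι n
ι-+ m n = toℚᵘ-injective (ℚᵘ.≃-trans (toℚᵘ-ι (m ℕ.+ n)) (ℚᵘ.≃-trans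
  (*≡* (cong (ℤ._* + 1) (cong₂ ℤ._+_ (sym (ℤ.*-identityʳ (+ m))) (sym (ℤ.*-identityʳ (+ n))))))
  (ℚᵘ.≃-sym (ℚᵘ.≃-trans (toℚᵘ-homo-+ (ι m) (ι n)) (ℚᵘ.+-cong (toℚᵘ-ι m) (toℚᵘ-ι n))))))

ι-suc≢0 : ∀ n → ι (suc n) ≢ 0ℚ
ι-suc≢0 n eq with ℚᵘ.≃-trans (ℚᵘ.≃-sym (toℚᵘ-ι (suc n))) (toℚᵘ-cong eq)
... | *≡* ()

Invertible : ℚ → Set
Invertible p = ∃ λ q → p * q ≡ 1ℚ

inverse-suc : ∀ n → ∃ λ r → Invertible r × r * ι (suc n) ≡ 1ℚ
inverse-suc n = let instance _ = ≢-nonZero (ι-suc≢0 n) in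
  1/ ι (suc n) , (ι (suc n) , *-inverseˡ (ι (suc n))) , *-inverseˡ (ι (suc n))

Invertible-* : ∀ p q → Invertible p → Invertible q → Invertible (p * q)
Invertible-* p q (p′ , hp) (q′ , hq) = p′ * q′ , (begin
  p * q * (p′ * q′)   ≡⟨ solve 4 (λ p q p′ q′ → p :* q :* (p′ :* q′) := p :* p′ :* (q :* q′)) refl p q p′ q′ ⟩
  p * p′ * (q * q′)   ≡⟨ cong₂ _*_ hp hq ⟩
  1ℚ ∎)

*-nonzero : ∀ {p q} → p ≢ 0ℚ → Invertible q → p * q ≢ 0ℚ
*-nonzero {p} {q} p≢0 (q′ , hq) pq≡0 = p≢0 (begin
  p             ≡⟨ *-identityʳ p ⟨
  p * 1ℚ        ≡⟨ cong (p *_) hq ⟨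
  p * (q * q′)  ≡⟨ *-assoc p q q′ ⟨
  p * q * q′    ≡⟨ cong (_* q′) pq≡0 ⟩
  0ℚ * q′       ≡⟨ *-zeroˡ q′ ⟩
  0ℚ            ∎)

-- Sequences with a constant iterated difference.

Δ : (ℕ → ℚ) → ℕ → ℚ
Δ f m = f (suc m) - f m

-- Polynomials of degree at most d whose coefficient in degree d is c / d!. Since c may be 0, sums
-- need no case distinction on degrees.
ConstantDiff : ℕ → ℚ → (ℕ → ℚ) → Set
ConstantDiff zero    c f = ∀ m → f m ≡ c
ConstantDiff (suc d) c f = ConstantDiff d c (Δ f)

ConstantDiff-cong : ∀ d {c f g} → (∀ m → f m ≡ g m) → ConstantDiff d c f → ConstantDiff d c g
ConstantDiff-cong zero    f≗g h m = trans (sym (f≗g m)) (h m)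
ConstantDiff-cong (suc d) f≗g h =
  ConstantDiff-cong d (λ m → cong₂ _-_ (f≗g (suc m)) (f≗g m)) h

ConstantDiff-+ : ∀ d {c c′ f g} → ConstantDiff d c f → ConstantDiff d c′ g →
  ConstantDiff d (c + c′) (λ m → f m + g m)
ConstantDiff-+ zero    hf hg m = cong₂ _+_ (hf m) (hg m)
ConstantDiff-+ (suc d) {f = f} {g} hf hg = ConstantDiff-cong d
  (λ m → solve 4 (λ a b c d → (a :- b) :+ (c :- d) := (a :+ c) :- (b :+ d)) refl
    (f (suc m)) (f m) (g (suc m)) (g m))
  (ConstantDiff-+ d hf hg)

ConstantDiff-shift : ∀ d {c f} → ConstantDiff d c f → ConstantDiff d c (f ∘ suc)
ConstantDiff-shift zero    h = h ∘ suc
ConstantDiff-shift (suc d) h = ConstantDiff-shift d h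

ConstantDiff-raise : ∀ d {c f} → ConstantDiff d c f → ConstantDiff (suc d) 0ℚ f
ConstantDiff-raise zero {c} h m = trans (cong₂ _-_ (h (suc m)) (h m)) (+-inverseʳ c)
ConstantDiff-raise (suc d) h = ConstantDiff-raise d h

ConstantDiff-lower : ∀ d {f} → ConstantDiff (suc d) 0ℚ f → ∃ λ c → ConstantDiff d c f
ConstantDiff-lower zero {f} h = f 0 , constant
  where
  constant : ∀ m → f m ≡ f 0
  constant zero    = refl
  constant (suc m) = begin
    f (suc m)              ≡⟨ solve 2 (λ a b → a := (a :- b) :+ b) refl (f (suc m)) (f m) ⟩
    f (suc m) - f m + f m  ≡⟨ cong₂ _+_ (h m) (constant m) ⟩
    0ℚ + f 0               ≡⟨ +-identityˡ (f 0) ⟩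
    f 0                    ∎
ConstantDiff-lower (suc d) h = ConstantDiff-lower d h

-- From differences to coefficients through binomial coefficients.

binom : ℕ → ℕ → ℚ
binom zero    m       = 1ℚ
binom (suc i) zero    = 0ℚ
binom (suc i) (suc m) = binom (suc i) m + binom i m

binom-diff : ∀ d c → ConstantDiff d c (λ m → c * binom d m)
binom-diff zero    c m = *-identityʳ c
binom-diff (suc d) c = ConstantDiff-cong d
  (λ m → solve 3 (λ c a b → c :* b := c :* (a :+ b) :- c :* a) refl c (binom (suc d) m) (binom d m))
  (binom-diff d c)

-- The absorption identity, by Pascal's rule. It exhibits each binomial coefficient as the previous
-- one times a linear factor.
binom-absorb : ∀ i m → binom (suc i) m * ι (suc i) ≡ binom i m * (ι m - ι i)
binom-absorb zero    zero    = refl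
binom-absorb (suc i) zero    = trans (*-zeroˡ (ι (2 ℕ.+ i))) (sym (*-zeroˡ (ι 0 - ι (suc i))))
binom-absorb zero    (suc m) = begin
  (binom 1 m + 1ℚ) * 1ℚ
    ≡⟨ solve 1 (λ b → (b :+ con 1ℚ) :* con 1ℚ := b :* con 1ℚ :+ con 1ℚ) refl (binom 1 m) ⟩
  binom 1 m * 1ℚ + 1ℚ
    ≡⟨ cong (_+ 1ℚ) (binom-absorb zero m) ⟩
  1ℚ * (ι m - 0ℚ) + 1ℚ
    ≡⟨ solve 1 (λ m → con 1ℚ :* (m :- con 0ℚ) :+ con 1ℚ := con 1ℚ :* (con 1ℚ :+ m :- con 0ℚ)) refl (ι m) ⟩
  1ℚ * (1ℚ + ι m - 0ℚ)
    ≡⟨ cong (λ x → 1ℚ * (x - 0ℚ)) (ι-+ 1 m) ⟨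
  1ℚ * (ι (suc m) - 0ℚ) ∎
binom-absorb (suc i) (suc m) = begin
  (B₂ + B₁) * ι (2 ℕ.+ i)
    ≡⟨ cong ((B₂ + B₁) *_) (ι-+ 1 (suc i)) ⟩
  (B₂ + B₁) * (1ℚ + ι (suc i))
    ≡⟨ solve 3 (λ a b j → (a :+ b) :* (con 1ℚ :+ j) := a :* (con 1ℚ :+ j) :+ b :* (con 1ℚ :+ j)) refl B₂ B₁ (ι (suc i)) ⟩
  B₂ * (1ℚ + ι (suc i)) + B₁ * (1ℚ + ι (suc i))
    ≡⟨ cong (λ x → B₂ * x + B₁ * (1ℚ + ι (suc i))) (ι-+ 1 (suc i)) ⟨
  B₂ * ι (2 ℕ.+ i) + B₁ * (1ℚ + ι (suc i))
    ≡⟨ cong (_+ B₁ * (1ℚ + ι (suc i))) (binom-absorb (suc i) m) ⟩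
  B₁ * (ι m - ι (suc i)) + B₁ * (1ℚ + ι (suc i))
    -- The regrouping isolates `B₁ * ι (suc i)`, to which the identity for the smaller index
    -- applies.
    ≡⟨ solve 3 (λ b m j → b :* (m :- j) :+ b :* (con 1ℚ :+ j) := b :* (con 1ℚ :+ m :- j) :+ b :* j) refl B₁ (ι m) (ι (suc i)) ⟩
  B₁ * (1ℚ + ι m - ι (suc i)) + B₁ * ι (suc i)
    ≡⟨ cong (λ x → B₁ * (1ℚ + ι m - ι (suc i)) + x) (binom-absorb i m) ⟩
  B₁ * (1ℚ + ι m - ι (suc i)) + B₀ * (ι m - ι i)
    ≡⟨ cong (λ x → B₁ * (1ℚ + ι m - x) + B₀ * (ι m - ι i)) (ι-+ 1 i) ⟩
  B₁ * (1ℚ + ι m - (1ℚ + ι i)) + B₀ * (ι m - ι i)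
    ≡⟨ solve 4 (λ b a m i → b :* (con 1ℚ :+ m :- (con 1ℚ :+ i)) :+ a :* (m :- i) := (b :+ a) :* (con 1ℚ :+ m :- (con 1ℚ :+ i)))
         refl B₁ B₀ (ι m) (ι i) ⟩
  (B₁ + B₀) * (1ℚ + ι m - (1ℚ + ι i))
    ≡⟨ cong₂ (λ x y → (B₁ + B₀) * (x - y)) (ι-+ 1 m) (ι-+ 1 i) ⟨
  (B₁ + B₀) * (ι (suc m) - ι (suc i)) ∎
  where
  B₂ = binom (2 ℕ.+ i) m
  B₁ = binom (suc i) m
  B₀ = binom i m

-- The argument is shifted by N: coefficients are taken in x = m + N.
IsPolynomial : ℕ → ℕ → ℚ → (ℕ → ℚ) → Set
IsPolynomial N d c f = Σ (List ℚ) λ cs → length cs ≡ d ×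
  (∀ m → f m ≡ evalPoly (cs ++ c ∷ []) (ι (m ℕ.+ N)))

IsPolynomial-cong : ∀ {N d c f g} → (∀ m → f m ≡ g m) → IsPolynomial N d c f → IsPolynomial N d c g
IsPolynomial-cong f≗g (cs , len , eq) = cs , len , λ m → trans (sym (f≗g m)) (eq m)

-- The constant k serves the induction: k + (x - r)(e + x q) = (k - r e) + x (e + (x - r) q), so e
-- is the next k. The top coefficient is preserved.
evalPoly-linear : ∀ r c k cs → ∃ λ ds → length ds ≡ suc (length cs) ×
  (∀ x → k + (x - r) * evalPoly (cs ++ c ∷ []) x ≡ evalPoly (ds ++ c ∷ []) x)
evalPoly-linear r c k [] = (k - r * c) ∷ [] , refl , λ x →
  solve 4 (λ k r c x → k :+ (x :- r) :* (c :+ x :* con 0ℚ) := (k :- r :* c) :+ x :* (c :+ x :* con 0ℚ)) refl k r c x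
evalPoly-linear r c k (e ∷ cs) =
  let ds , len , eq = evalPoly-linear r c e cs in
  (k - r * e) ∷ ds , cong suc len , λ x → trans
    (solve 5 (λ k r e x q → k :+ (x :- r) :* (e :+ x :* q) := (k :- r :* e) :+ x :* (e :+ (x :- r) :* q)) refl
      k r e x (evalPoly (cs ++ c ∷ []) x))
    (cong (λ y → k - r * e + x * y) (eq x))

evalPoly-scale : ∀ s c cs x → s * evalPoly (cs ++ c ∷ []) x ≡ evalPoly (map (s *_) cs ++ s * c ∷ []) x
evalPoly-scale s c [] x =
  solve 3 (λ s c x → s :* (c :+ x :* con 0ℚ) := s :* c :+ x :* con 0ℚ) refl s c x
evalPoly-scale s c (e ∷ cs) x = trans
  (solve 4 (λ s e x q → s :* (e :+ x :* q) := s :* e :+ x :* (s :* q)) refl s e x (evalPoly (cs ++ c ∷ []) x))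
  (cong (λ y → s * e + x * y) (evalPoly-scale s c cs x))

evalPoly-+ : ∀ c cs es x → length cs ≡ length es →
  evalPoly (cs ++ c ∷ []) x + evalPoly es x ≡ evalPoly (zipWith _+_ cs es ++ c ∷ []) x
evalPoly-+ c []       []       x len = +-identityʳ _
evalPoly-+ c (a ∷ cs) (e ∷ es) x len = trans
  (solve 5 (λ a e x p q → a :+ x :* p :+ (e :+ x :* q) := a :+ e :+ x :* (p :+ q)) refl
    a e x (evalPoly (cs ++ c ∷ []) x) (evalPoly es x))
  (cong (λ y → a + e + x * y) (evalPoly-+ c cs es x (ℕ.suc-injective len)))

IsPolynomial-scale : ∀ {N d c f} s → IsPolynomial N d c f → IsPolynomial N d (s * c) (λ m → s * f m)
IsPolynomial-scale {c = c} s (cs , len , eq) = map (s *_) cs , trans (length-map (s *_) cs) len ,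
  λ m → trans (cong (s *_) (eq m)) (evalPoly-scale s c cs _)

IsPolynomial-+ : ∀ {N d c c′ f g} → IsPolynomial N (suc d) c f → IsPolynomial N d c′ g →
  IsPolynomial N (suc d) c (λ m → f m + g m)
IsPolynomial-+ {N} {d} {c} {c′} (cs , len , eq) (es , len′ , eq′) =
  zipWith _+_ cs (es ++ c′ ∷ []) ,
  trans (length-zipWith _+_ cs (es ++ c′ ∷ []))
    (trans (cong (ℕ._⊓_ (length cs)) (sym same)) (trans (ℕ.⊓-idem (length cs)) len)) ,
  λ m → trans (cong₂ _+_ (eq m) (eq′ m)) (evalPoly-+ c cs (es ++ c′ ∷ []) (ι (m ℕ.+ N)) same)
  where
  same : length cs ≡ length (es ++ c′ ∷ [])
  same = begin
    length cs               ≡⟨ len ⟩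
    suc d                   ≡⟨ cong suc len′ ⟨
    suc (length es)         ≡⟨ ℕ.+-comm 1 (length es) ⟩
    length es ℕ.+ 1         ≡⟨ length-++ es ⟨
    length (es ++ c′ ∷ [])  ∎

-- Absorption multiplies by (m - d) / (d + 1) at each step, so the leading coefficient is 1 / d!,
-- which is invertible.
binom-polynomial : ∀ N d → ∃ λ c → Invertible c × IsPolynomial N d c (binom d)
binom-polynomial N zero = 1ℚ , (1ℚ , refl) , [] , refl ,
  λ m → solve 1 (λ x → con 1ℚ := con 1ℚ :+ x :* con 0ℚ) refl (ι (m ℕ.+ N))
binom-polynomial N (suc d) =
  let c , c⁻¹ , cs , len , eq = binom-polynomial N d
      r , r⁻¹ , rd≡1 = inverse-suc d
      -- In the variable x = m + N the factor m - d has the root N + d.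
      ds , len′ , eq′ = evalPoly-linear (ι N + ι d) c 0ℚ cs
  in r * c , Invertible-* r c r⁻¹ c⁻¹ ,
     IsPolynomial-cong (λ m → begin
       r * (binom d m * (ι m - ι d))      ≡⟨ cong (r *_) (binom-absorb d m) ⟨
       r * (binom (suc d) m * ι (suc d))  ≡⟨ solve 3 (λ r b s → r :* (b :* s) := r :* s :* b) refl r (binom (suc d) m) (ι (suc d)) ⟩
       r * ι (suc d) * binom (suc d) m    ≡⟨ cong (_* binom (suc d) m) rd≡1 ⟩
       1ℚ * binom (suc d) m               ≡⟨ *-identityˡ _ ⟩
       binom (suc d) m                    ∎)
       (IsPolynomial-scale {f = λ m → binom d m * (ι m - ι d)} r (ds , trans len′ (cong suc len) , λ m → begin
       binom d m * (ι m - ι d)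
         ≡⟨ solve 4 (λ b m d n → b :* (m :- d) := con 0ℚ :+ (m :+ n :- (n :+ d)) :* b) refl (binom d m) (ι m) (ι d) (ι N) ⟩
       0ℚ + (ι m + ι N - (ι N + ι d)) * binom d m
         ≡⟨ cong₂ (λ x b → 0ℚ + (x - (ι N + ι d)) * b) (sym (ι-+ m N)) (eq m) ⟩
       0ℚ + (ι (m ℕ.+ N) - (ι N + ι d)) * evalPoly (cs ++ c ∷ []) (ι (m ℕ.+ N))
         ≡⟨ eq′ (ι (m ℕ.+ N)) ⟩
       evalPoly (ds ++ c ∷ []) (ι (m ℕ.+ N)) ∎))

-- Newton's expansion: subtracting c times the top binomial coefficient annihilates the top
-- difference, and the rest has lower degree. Its own constant may be anything, since it cannot
-- affect the leading coefficient.
ConstantDiff⇒IsPolynomial : ∀ N d {c} f → ConstantDiff d c f → ∃ λ s → Invertible s × IsPolynomial N d (c * s) f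
ConstantDiff⇒IsPolynomial N zero {c} f h = 1ℚ , (1ℚ , refl) , [] , refl , λ m → trans (h m)
  (solve 2 (λ c x → c := c :* con 1ℚ :+ x :* con 0ℚ) refl c (ι (m ℕ.+ N)))
ConstantDiff⇒IsPolynomial N (suc d) {c} f h =
  let s , s⁻¹ , top = binom-polynomial N (suc d)
      _ , h′ = ConstantDiff-lower d (subst (λ e → ConstantDiff (suc d) e rest) (+-inverseʳ c)
        (ConstantDiff-+ (suc d) {f = f} h (binom-diff (suc d) (- c))))
      _ , _ , low = ConstantDiff⇒IsPolynomial N d rest h′
  in s , s⁻¹ , IsPolynomial-cong
       (λ m → solve 3 (λ c b f → c :* b :+ (f :+ (:- c) :* b) := f) refl c (binom (suc d) m) (f m))
       (IsPolynomial-+ (IsPolynomial-scale c top) low)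
  where
  rest : ℕ → ℚ
  rest m = f m + (- c) * binom (suc d) m

-- Sequences of Fibonacci type plus a polynomial.

F : ℕ → ℚ
F n = ι (fib n)

F-rec : ∀ n → F (2 ℕ.+ n) ≡ F (suc n) + F n
F-rec n = ι-+ (fib (suc n)) (fib n)

residue : ℚ → ℚ → (ℕ → ℚ) → ℕ → ℚ
residue a b f m = f m - (a * F m + b * F (suc m))

record FibPoly (d : ℕ) (c : ℚ) (f : ℕ → ℚ) : Set where
  constructor fibPoly
  field
    a b : ℚ
    residue-diff : ConstantDiff d c (residue a b f)

FibPoly-cong : ∀ {d c f g} → (∀ m → f m ≡ g m) → FibPoly d c f → FibPoly d c g
FibPoly-cong {d} f≗g (fibPoly a b h) =
  fibPoly a b (ConstantDiff-cong d (λ m → cong (_- (a * F m + b * F (suc m))) (f≗g m)) h)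

FibPoly-raise : ∀ {d c f} → FibPoly d c f → FibPoly (suc d) 0ℚ f
FibPoly-raise {d} (fibPoly a b h) = fibPoly a b (ConstantDiff-raise d h)

FibPoly-+ : ∀ {d c c′ f g} → FibPoly d c f → FibPoly d c′ g → FibPoly d (c + c′) (λ m → f m + g m)
FibPoly-+ {d} {f = f} {g} (fibPoly a b hf) (fibPoly a′ b′ hg) = fibPoly (a + a′) (b + b′) (ConstantDiff-cong d
  (λ m → solve 8 (λ a b a′ b′ x y f g →
      f :- (a :* x :+ b :* y) :+ (g :- (a′ :* x :+ b′ :* y)) := f :+ g :- ((a :+ a′) :* x :+ (b :+ b′) :* y)) refl
    a b a′ b′ (F m) (F (suc m)) (f m) (g m))
  (ConstantDiff-+ d hf hg))

-- On Fibonacci-type sequences Δ is inverse to the shift, because F (m + 2) - F (m + 1) = F m.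
FibPoly-shift : ∀ {d c f} → FibPoly d c f → FibPoly d c (f ∘ suc)
FibPoly-shift {d} {f = f} (fibPoly a b h) = fibPoly b (a + b) (ConstantDiff-cong d
  (λ m → trans (cong (λ z → f (suc m) - (a * F (suc m) + b * z)) (F-rec m))
    (solve 5 (λ a b x y f → f :- (a :* y :+ b :* (y :+ x)) := f :- (b :* x :+ (a :+ b) :* y)) refl
      a b (F m) (F (suc m)) (f (suc m))))
  (ConstantDiff-shift d h))

-- `b * F m + (a + b) * F (suc m)` has difference `a * F m + b * F (suc m)`. Subtracting it from f
-- leaves a residue whose difference is the residue of `Δ f`.
FibPoly-sum : ∀ {d c f} → FibPoly d c (Δ f) → FibPoly (suc d) c f
FibPoly-sum {d} {f = f} (fibPoly a b h) = fibPoly b (a + b) (ConstantDiff-cong d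
  (λ m → trans
    (solve 6 (λ a b x y f f′ → f′ :- f :- (a :* x :+ b :* y)
        := f′ :- (b :* y :+ (a :+ b) :* (y :+ x)) :- (f :- (b :* x :+ (a :+ b) :* y))) refl
      a b (F m) (F (suc m)) (f m) (f (suc m)))
    (cong (λ z → f (suc m) - (b * F (suc m) + (a + b) * z) - (f m - (b * F m + (a + b) * F (suc m))))
      (sym (F-rec m))))
  h)

fibonacci-affine : ∀ g → (∀ m → g (2 ℕ.+ m) ≡ g (suc m) + (1ℚ + g m)) → FibPoly 0 (- 1ℚ) g
fibonacci-affine g rec = fibPoly a b constant
  where
  -- These solve a F₀ + b F₁ = g 0 + 1 and a F₁ + b F₂ = g 1 + 1. Each later residue is the sum of
  -- the two before it plus 1, which keeps it at -1.
  a = g 1 - g 0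
  b = g 0 + 1ℚ
  constant : ∀ m → residue a b g m ≡ - 1ℚ
  constant 0 = solve 2 (λ g₀ g₁ → g₀ :- ((g₁ :- g₀) :* con 0ℚ :+ (g₀ :+ con 1ℚ) :* con 1ℚ) := :- con 1ℚ) refl (g 0) (g 1)
  constant 1 = solve 2 (λ g₀ g₁ → g₁ :- ((g₁ :- g₀) :* con 1ℚ :+ (g₀ :+ con 1ℚ) :* con 1ℚ) := :- con 1ℚ) refl (g 0) (g 1)
  constant (suc (suc m)) = begin
    g (2 ℕ.+ m) - (a * F (2 ℕ.+ m) + b * F (3 ℕ.+ m))
      ≡⟨ cong₂ (λ x y → x - (a * F (2 ℕ.+ m) + b * y)) (rec m) (F-rec (suc m)) ⟩
    g (suc m) + (1ℚ + g m) - (a * F (2 ℕ.+ m) + b * (F (2 ℕ.+ m) + F (suc m)))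
      ≡⟨ cong (λ x → g (suc m) + (1ℚ + g m) - (a * x + b * (F (2 ℕ.+ m) + F (suc m)))) (F-rec m) ⟩
    g (suc m) + (1ℚ + g m) - (a * (F (suc m) + F m) + b * (F (2 ℕ.+ m) + F (suc m)))
      ≡⟨ solve 7 (λ a b x y z g₀ g₁ → g₁ :+ (con 1ℚ :+ g₀) :- (a :* (y :+ x) :+ b :* (z :+ y))
           := g₁ :- (a :* y :+ b :* z) :+ (g₀ :- (a :* x :+ b :* y)) :+ con 1ℚ) refl
           a b (F m) (F (suc m)) (F (2 ℕ.+ m)) (g m) (g (suc m)) ⟩
    residue a b g (suc m) + residue a b g m + 1ℚ
      ≡⟨ cong₂ (λ x y → x + y + 1ℚ) (constant (suc m)) (constant m) ⟩
    - 1ℚ + - 1ℚ + 1ℚ ∎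

-- Solving the recurrences.

u t : ℕ → ℕ → ℚ
u i m = ι (φ i (suc (i ℕ.+ m)))
t i m = ι (ψ i (suc (i ℕ.+ m)))

u-zero : FibPoly 0 (- 1ℚ) (u 0)
u-zero = fibonacci-affine (u 0) λ m → trans (cong ι (φ-zero m))
  (trans (ι-+ (φ 0 (2 ℕ.+ m)) (1 ℕ.+ φ 0 (1 ℕ.+ m))) (cong (_+_ (u 0 (suc m))) (ι-+ 1 (φ 0 (1 ℕ.+ m)))))

-- `ψ-suc` lowers i and the size together; sampling row i from size `suc i` onwards makes it an
-- identity at a fixed m.
t-suc : ∀ i m → t (suc i) m ≡ u i m + t i m
t-suc i m = trans (cong ι (ψ-suc i (i ℕ.+ m))) (ι-+ (φ i (suc (i ℕ.+ m))) _)

Δt-zero : ∀ m → Δ (t 0) m ≡ u 0 m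
Δt-zero m = begin
  t 0 (suc m) - t 0 m    ≡⟨ cong (_- t 0 m) (trans (cong ι (ψ-zero m)) (ι-+ (φ 0 (suc m)) _)) ⟩
  u 0 m + t 0 m - t 0 m  ≡⟨ solve 2 (λ x y → x :+ y :- y := x) refl (u 0 m) (t 0 m) ⟩
  u 0 m                  ∎

Δu-suc : ∀ i m → Δ (u (suc i)) m ≡ u i (suc m) + t (suc i) m
Δu-suc i m = begin
  ι (φ (suc i) (2 ℕ.+ (i ℕ.+ suc m))) - u (suc i) m
    ≡⟨ cong (λ x → ι x - u (suc i) m) (φ-suc i (i ℕ.+ suc m)) ⟩
  ι (φ i k ℕ.+ φ (suc i) k ℕ.+ ψ (suc i) k) - u (suc i) m
    ≡⟨ cong (_- u (suc i) m) (trans (ι-+ (φ i k ℕ.+ φ (suc i) k) (ψ (suc i) k)) (cong (_+ ι (ψ (suc i) k)) (ι-+ (φ i k) (φ (suc i) k)))) ⟩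
  u i (suc m) + ι (φ (suc i) k) + ι (ψ (suc i) k) - u (suc i) m
    ≡⟨ cong (λ n → u i (suc m) + ι (φ (suc i) (suc n)) + ι (ψ (suc i) (suc n)) - u (suc i) m) (ℕ.+-suc i m) ⟩
  u i (suc m) + u (suc i) m + t (suc i) m - u (suc i) m
    ≡⟨ solve 3 (λ x y z → x :+ y :+ z :- y := x :+ z) refl (u i (suc m)) (u (suc i) m) (t (suc i) m) ⟩
  u i (suc m) + t (suc i) m ∎
  where k = suc (i ℕ.+ suc m)

doubled≢0 : ∀ {c} → c ≢ 0ℚ → c + (c + 0ℚ) ≢ 0ℚ
doubled≢0 {c} c≢0 eq = c≢0 (begin
  c                    ≡⟨ solve 1 (λ c → c := con ½ :* (c :+ (c :+ con 0ℚ))) refl c ⟩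
  ½ * (c + (c + 0ℚ))   ≡⟨ cong (½ *_) eq ⟩
  0ℚ                   ∎)

FibPoly-u-suc : ∀ i {d c c′} → FibPoly d c (u i) → FibPoly d c′ (t (suc i)) → FibPoly (suc d) (c + c′) (u (suc i))
FibPoly-u-suc i hu ht =
  FibPoly-sum (FibPoly-cong (λ m → sym (Δu-suc i m)) (FibPoly-+ (FibPoly-shift hu) ht))

-- `t (suc i)` has a lower degree bound than `u (suc i)`, so `t (2 + i)` inherits the constant c
-- from `u (suc i)`. The difference of `u (2 + i)` then collects c twice, once from the shifted
-- `u (suc i)` and once from `t (2 + i)`.
fibPoly-u-t : ∀ i → ∃₂ λ c c′ → c ≢ 0ℚ × FibPoly (2 ℕ.+ i) c (u (suc i)) × FibPoly (suc i) c′ (t (suc i))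
-- At the start the roles are reversed: `t 0` is a sum of `u 0`, so its degree bound is the higher
-- one, and the constant -1 comes from it.
fibPoly-u-t zero = _ , _ , (λ ()) , FibPoly-u-suc 0 (FibPoly-raise u-zero) t₁ , t₁
  where
  t₁ : FibPoly 1 (0ℚ + - 1ℚ) (t 1)
  t₁ = FibPoly-cong (λ m → sym (t-suc 0 m))
    (FibPoly-+ (FibPoly-raise u-zero) (FibPoly-sum (FibPoly-cong (λ m → sym (Δt-zero m)) u-zero)))
fibPoly-u-t (suc i) =
  let c , c′ , c≢0 , hu , ht = fibPoly-u-t i
      ht′ = FibPoly-cong (λ m → sym (t-suc (suc i) m)) (FibPoly-+ hu (FibPoly-raise ht))
  in _ , _ , doubled≢0 c≢0 , FibPoly-u-suc (suc i) hu ht′ , ht′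

-- Returning to the size n and integer Fibonacci indices.

fibℤ-shift : ∀ r m n → n ≡ suc r ℕ.+ m → fibℤ (+ n ℤ.+ -[1+ r ]) ≡ + fib m
fibℤ-shift r m n refl = cong fibℤ (trans (ℤ.⊖-≥ (ℕ.m≤m+n (suc r) m)) (cong +_ (ℕ.m+n∸m≡n (suc r) m)))

theorem4p13 : (k : ℕ) → 4 ≤ k →
    Σ ℚ λ a → Σ ℚ λ b → Σ ℤ λ r → Σ ℤ λ s →
    Σ (List ℚ) λ cs → Σ ℚ λ c →
    (length cs ≡ k ∸ 2) × (¬ c ≡ 0ℚ) ×
    ((n : ℕ) → k ≤ n →
    ℤtoℚ (+ countAvoid (p132 ∷ tau k ∷ p2341 ∷ []) n)
    ≡ a * ℤtoℚ (fibℤ (+ n Data.Integer.+ r))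
    + b * ℤtoℚ (fibℤ (+ n Data.Integer.+ s))
    + evalPoly (cs ++ c ∷ []) (ℤtoℚ (+ n)))
theorem4p13 _ (s≤s (s≤s (s≤s (s≤s (z≤n {i}))))) =
  let c , _ , c≢0 , fibPoly a b h , _ = fibPoly-u-t i
      -- Here 2 + i = k - 2 is both the degree and the offset: `u (suc i) m` counts permutations of
      -- size 2 + i + m.
      s , s⁻¹ , cs , len , eq = ConstantDiff⇒IsPolynomial (2 ℕ.+ i) (2 ℕ.+ i) (residue a b (u (suc i))) h
  -- The shifts -(k - 2) and -(k - 3) send n to m and m + 1, so no negative Fibonacci index occurs.
  in a , b , -[1+ suc i ] , -[1+ i ] , cs , c * s , len , *-nonzero c≢0 s⁻¹ , λ n k≤n →
     let m = n ∸ (2 ℕ.+ i)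
         n≡ : n ≡ 2 ℕ.+ i ℕ.+ m
         n≡ = sym (ℕ.m+[n∸m]≡n (ℕ.≤-trans (ℕ.m≤n+m (2 ℕ.+ i) 2) k≤n))
     in begin
       ι (countAvoid (p132 ∷ tau (4 ℕ.+ i) ∷ p2341 ∷ []) n)
         ≡⟨ cong ι (trans (countAvoid-φ (suc i) n) (cong (φ (suc i)) n≡)) ⟩
       u (suc i) m
         ≡⟨ solve 2 (λ x y → x := y :+ (x :- y)) refl (u (suc i) m) (a * F m + b * F (suc m)) ⟩
       a * F m + b * F (suc m) + residue a b (u (suc i)) m
         ≡⟨ cong₂ _+_ (cong₂ (λ x y → a * ℤtoℚ x + b * ℤtoℚ y)
              (sym (fibℤ-shift (suc i) m n n≡))
              (sym (fibℤ-shift i (suc m) n (trans n≡ (sym (ℕ.+-suc (suc i) m))))))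
            (trans (eq m) (cong (evalPoly (cs ++ c * s ∷ []) ∘ ι) (trans (ℕ.+-comm m (2 ℕ.+ i)) (sym n≡)))) ⟩
       a * ℤtoℚ (fibℤ (+ n ℤ.+ -[1+ suc i ])) + b * ℤtoℚ (fibℤ (+ n ℤ.+ -[1+ i ]))
         + evalPoly (cs ++ c * s ∷ []) (ι n) ∎
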